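{- Let $(X,\mathcal F)$ be a (finite) hypergraph with maximum degree $\Delta$. Let $0<\varepsilon\leq 1$, let $0<\lambda<1$ be such that $\frac{ -\ln\lambda}{1-\lambda}\leq 1+\frac{\varepsilon}{2}$, and set $$f:=\left\lceil\frac{2(1+\ln\Delta)}{\varepsilon(1-\lambda)}\right\rceil .$$ Let $\tau_f$ denote the $f$-fold transversal number and $\tau^{\ast}$ the fractional transversal number of $(X,\mathcal F)$. Then $$\tau^{\ast}\leq \frac{\tau_f}{f}\leq \tau^{\ast}(1+\varepsilon).$$ Moreover, if $\lambda$ is rational and $A$ is the $f$-fold transversal produced by the $\lambda$-weighted greedy algorithm (described in the context), then the function $w:X\to\mathbb R$, $w(x)=\frac{1}{f}\cdot(\text{multiplicity of } x \text{ in } A)$, is a fractional transversal of $(X,\mathcal F)$ with $\tau^{\ast}\le\sum_{x\in X}w(x)\leq \tau^{\ast}(1+\varepsilon)$.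
   Context: A hypergraph is a pair $(X,\mathcal F)$, where $X$ is a finite set (the vertices) and $\mathcal F\subseteq 2^X$ is a family of subsets of $X$ (the edges). It is tacitly assumed that $\mathcal F$ is nonempty and that every edge is nonempty. The maximum degree $\Delta$ is the maximum number of edges a vertex is contained in. An $f$-fold transversal of $(X,\mathcal F)$ is a multiset $A$ of elements of $X$ such that each $F\in\mathcal F$ contains at least $f$ elements of $A$, counted with multiplicity. The $f$-fold transversal number $\tau_f$ is the minimum cardinality (with multiplicity) of an $f$-fold transversal. A fractional transversal is a function $w:X\to[0,1]$ with $\sum_{x\in F}w(x)\ge 1$ for all $F\in\mathcal F$; the fractional transversal number is $\tau^{\ast}=\inf\{\sum_{x\in X}w(x) : w \text{ is a fractional transversal}\}$. The $\lambda$-weighted greedy algorithm: vertices are picked one by one, with repetition allowed. At any stage, for $F\in\mathcal F$ let $k(F)$ be the number of vertices picked so far (with multiplicity) that lie in $F$; initially $k\equiv 0$. The value of a vertex $x$ at this stage is $v_k(x)=\sum_{F\in\mathcal F,\ x\in F,\ k(F)<f}\lambda^{k(F)}$. At each step one picks a vertex of largest value (ties broken arbitrarily). The algorithm stops once $k(F)\ge f$ for every $F\in\mathcal F$; its output is the multiset of picked vertices. -}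

module Defs where

open import Data.Fin using (Fin; _≟_)
open import Data.Fin.Subset using (Subset; _∈_; Nonempty)
open import Data.Fin.Subset.Properties using (_∈?_)
open import Data.Integer as ℤ using (ℤ; +_)
open import Data.List using (List; []; _∷_; map; filter; length; sum; allFin)
open import Data.List.Extrema.Nat using (max)
open import Data.List.Membership.Propositional using () renaming (_∈_ to _∈ᴸ_)
open import Data.List.Relation.Unary.All using (All)
open import Data.List.Relation.Unary.Unique.Propositional using (Unique)
open import Data.Nat as ℕ using (ℕ; zero; suc; _⊔_)
import Data.Nat.Properties as ℕP
open import Data.Product using (Σ; ∃; _×_; _,_; proj₁; proj₂)
open import Data.Rational as ℚ using (ℚ; 0ℚ; 1ℚ; ½; ∣_∣)
import Data.Rational.Properties as ℚP
open import Data.Rational.Solver using (module +-*-Solver)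
open import Relation.Binary.PropositionalEquality
open import Relation.Nullary using (¬_; yes; no; contradiction)

open +-*-Solver

-- Real numbers are Cauchy sequences of rationals, with _≃_ as equality.
-- All field operations act pointwise on representing sequences.

Cauchy : (ℕ → ℚ) → Set
Cauchy x = ∀ e → 0ℚ ℚ.< e →
  ∃ λ N → ∀ m n → N ℕ.≤ m → N ℕ.≤ n → ∣ x m ℚ.- x n ∣ ℚ.≤ e

record ℝ : Set where
  constructor mkℝ
  field
    seq    : ℕ → ℚ
    cauchy : Cauchy seq
open ℝ public

infix 4 _≤ℝ_ _<ℝ_ _≃_

_≤ℝ_ : ℝ → ℝ → Set
x ≤ℝ y = ∀ e → 0ℚ ℚ.< e →
  ∃ λ N → ∀ n → N ℕ.≤ n → seq x n ℚ.≤ seq y n ℚ.+ e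

_<ℝ_ : ℝ → ℝ → Set
x <ℝ y = ∃ λ e → 0ℚ ℚ.< e ×
  (∃ λ N → ∀ n → N ℕ.≤ n → seq x n ℚ.+ e ℚ.≤ seq y n)

_≃_ : ℝ → ℝ → Set
x ≃ y = x ≤ℝ y × y ≤ℝ x

0<* : ∀ {p q} → 0ℚ ℚ.< p → 0ℚ ℚ.< q → 0ℚ ℚ.< p ℚ.* q
0<* {p} {q} p>0 q>0 = subst (ℚ._< p ℚ.* q) (ℚP.*-zeroʳ p)
  (ℚP.*-monoʳ-<-pos p {{ℚ.positive p>0}} q>0)

ℚ*-mono : ∀ {p q r s} → 0ℚ ℚ.≤ p → 0ℚ ℚ.≤ s → p ℚ.≤ q → r ℚ.≤ s →
         p ℚ.* r ℚ.≤ q ℚ.* s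
ℚ*-mono {p} {q} {r} {s} p≥0 s≥0 p≤q r≤s = ℚP.≤-trans
  (ℚP.*-monoˡ-≤-nonNeg p {{ℚ.nonNegative p≥0}} r≤s)
  (ℚP.*-monoʳ-≤-nonNeg s {{ℚ.nonNegative s≥0}} p≤q)

0<½ : 0ℚ ℚ.< ½
0<½ = ℚP.positive⁻¹ ½

half+half : ∀ e → ½ ℚ.* e ℚ.+ ½ ℚ.* e ≡ e
half+half = solve 1 (λ e → con ½ :* e :+ con ½ :* e := e) refl

-- Inversion of rationals, totalised by sending 0 to 0; only its values at
-- positive arguments matter below.
recip : ℚ → ℚ
recip p with p ℚP.≟ 0ℚ
... | yes _  = 0ℚ
... | no p≢0 = ℚ.1/_ p {{ℚ.≢-nonZero p≢0}}

recip-inverse : ∀ p → 0ℚ ℚ.< p → recip p ℚ.* p ≡ 1ℚ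
recip-inverse p p>0 with p ℚP.≟ 0ℚ
... | yes p≡0 = contradiction (sym p≡0) (ℚP.<⇒≢ p>0)
... | no p≢0  = ℚP.*-inverseˡ p {{ℚ.≢-nonZero p≢0}}

recip-pos : ∀ p → 0ℚ ℚ.< p → 0ℚ ℚ.< recip p
recip-pos p p>0 with p ℚP.≟ 0ℚ
... | yes p≡0 = contradiction (sym p≡0) (ℚP.<⇒≢ p>0)
... | no p≢0  = ℚP.positive⁻¹ _ {{ℚP.1/pos⇒pos p {{ℚ.positive p>0}}}}

fromℚ : ℚ → ℝ
fromℚ q = mkℝ (λ _ → q) λ e e>0 → 0 , λ _ _ _ _ →
  subst (λ d → ∣ d ∣ ℚ.≤ e) (sym (ℚP.+-inverseʳ q)) (ℚP.<⇒≤ e>0)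

fromℤ : ℤ → ℝ
fromℤ z = fromℚ (z ℚ./ 1)

fromℕ : ℕ → ℝ
fromℕ n = fromℤ (+ n)

0ℝ 1ℝ : ℝ
0ℝ = fromℕ 0
1ℝ = fromℕ 1

infixl 6 _+ℝ_ _-ℝ_
infixl 7 _*ℝ_
infix  8 -ℝ_
infixr 8 _^ℝ_

-ℝ_ : ℝ → ℝ
-ℝ (mkℝ x cx) = mkℝ (λ n → ℚ.- x n) λ e e>0 →
  let N , h = cx e e>0 in N , λ m n N≤m N≤n →
  subst (ℚ._≤ e)
    (trans (sym (ℚP.∣-p∣≡∣p∣ (x m ℚ.- x n)))
      (cong ∣_∣ (solve 2 (λ a b → :- (a :- b) := (:- a) :- (:- b)) refl (x m) (x n))))
    (h m n N≤m N≤n)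

_+ℝ_ : ℝ → ℝ → ℝ
mkℝ x cx +ℝ mkℝ y cy = mkℝ (λ n → x n ℚ.+ y n) λ e e>0 →
  let e′     = ½ ℚ.* e
      e′>0   = 0<* 0<½ e>0
      N , hx = cx e′ e′>0
      M , hy = cy e′ e′>0
  in N ⊔ M , λ m n ≤m ≤n → let open ℚP.≤-Reasoning in begin
    ∣ (x m ℚ.+ y m) ℚ.- (x n ℚ.+ y n) ∣
      ≡⟨ cong ∣_∣ (solve 4 (λ a b c d → (a :+ b) :- (c :+ d) := (a :- c) :+ (b :- d))
                    refl (x m) (y m) (x n) (y n)) ⟩
    ∣ (x m ℚ.- x n) ℚ.+ (y m ℚ.- y n) ∣
      ≤⟨ ℚP.∣p+q∣≤∣p∣+∣q∣ (x m ℚ.- x n) (y m ℚ.- y n) ⟩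
    ∣ x m ℚ.- x n ∣ ℚ.+ ∣ y m ℚ.- y n ∣
      ≤⟨ ℚP.+-mono-≤ (hx m n (ℕP.m⊔n≤o⇒m≤o N M ≤m) (ℕP.m⊔n≤o⇒m≤o N M ≤n))
                     (hy m n (ℕP.m⊔n≤o⇒n≤o N M ≤m) (ℕP.m⊔n≤o⇒n≤o N M ≤n)) ⟩
    e′ ℚ.+ e′
      ≡⟨ half+half e ⟩
    e ∎

_-ℝ_ : ℝ → ℝ → ℝ
x -ℝ y = x +ℝ (-ℝ y)

eventual-bound : ∀ x → Cauchy x →
  ∃ λ B → 0ℚ ℚ.< B × (∃ λ N → ∀ n → N ℕ.≤ n → ∣ x n ∣ ℚ.≤ B)
eventual-bound x cx =
  let N , h = cx 1ℚ (ℚP.positive⁻¹ 1ℚ)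
  in  1ℚ ℚ.+ ∣ x N ∣
    , ℚP.+-mono-<-≤ (ℚP.positive⁻¹ 1ℚ) (ℚP.0≤∣p∣ (x N))
    , N , λ n N≤n → let open ℚP.≤-Reasoning in begin
        ∣ x n ∣
          ≡⟨ cong ∣_∣ (solve 2 (λ a b → a := (a :- b) :+ b) refl (x n) (x N)) ⟩
        ∣ (x n ℚ.- x N) ℚ.+ x N ∣
          ≤⟨ ℚP.∣p+q∣≤∣p∣+∣q∣ (x n ℚ.- x N) (x N) ⟩
        ∣ x n ℚ.- x N ∣ ℚ.+ ∣ x N ∣
          ≤⟨ ℚP.+-monoˡ-≤ ∣ x N ∣ (h n N N≤n ℕP.≤-refl) ⟩
        1ℚ ℚ.+ ∣ x N ∣ ∎

_*ℝ_ : ℝ → ℝ → ℝ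
mkℝ x cx *ℝ mkℝ y cy = mkℝ (λ n → x n ℚ.* y n) λ e e>0 →
  let B , B>0 , Nb , hB = eventual-bound x cx
      C , C>0 , Nc , hC = eventual-bound y cy
      D     = B ℚ.+ C
      D>0   = ℚP.+-mono-< B>0 C>0
      e′    = recip D ℚ.* e
      e′>0  = 0<* (recip-pos D D>0) e>0
      N , hx = cx e′ e′>0
      M , hy = cy e′ e′>0
      K = (Nb ⊔ Nc) ⊔ (N ⊔ M)
      toNb = λ {k} (K≤k : K ℕ.≤ k) → ℕP.m⊔n≤o⇒m≤o Nb Nc (ℕP.m⊔n≤o⇒m≤o (Nb ⊔ Nc) (N ⊔ M) K≤k)
      toNc = λ {k} (K≤k : K ℕ.≤ k) → ℕP.m⊔n≤o⇒n≤o Nb Nc (ℕP.m⊔n≤o⇒m≤o (Nb ⊔ Nc) (N ⊔ M) K≤k)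
      toN  = λ {k} (K≤k : K ℕ.≤ k) → ℕP.m⊔n≤o⇒m≤o N M (ℕP.m⊔n≤o⇒n≤o (Nb ⊔ Nc) (N ⊔ M) K≤k)
      toM  = λ {k} (K≤k : K ℕ.≤ k) → ℕP.m⊔n≤o⇒n≤o N M (ℕP.m⊔n≤o⇒n≤o (Nb ⊔ Nc) (N ⊔ M) K≤k)
  in K , λ m n ≤m ≤n → let open ℚP.≤-Reasoning in begin
    ∣ x m ℚ.* y m ℚ.- x n ℚ.* y n ∣
      ≡⟨ cong ∣_∣ (solve 4 (λ a b c d → a :* b :- c :* d := a :* (b :- d) :+ d :* (a :- c))
                    refl (x m) (y m) (x n) (y n)) ⟩
    ∣ x m ℚ.* (y m ℚ.- y n) ℚ.+ y n ℚ.* (x m ℚ.- x n) ∣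
      ≤⟨ ℚP.∣p+q∣≤∣p∣+∣q∣ (x m ℚ.* (y m ℚ.- y n)) (y n ℚ.* (x m ℚ.- x n)) ⟩
    ∣ x m ℚ.* (y m ℚ.- y n) ∣ ℚ.+ ∣ y n ℚ.* (x m ℚ.- x n) ∣
      ≡⟨ cong₂ ℚ._+_ (ℚP.∣p*q∣≡∣p∣*∣q∣ (x m) (y m ℚ.- y n)) (ℚP.∣p*q∣≡∣p∣*∣q∣ (y n) (x m ℚ.- x n)) ⟩
    ∣ x m ∣ ℚ.* ∣ y m ℚ.- y n ∣ ℚ.+ ∣ y n ∣ ℚ.* ∣ x m ℚ.- x n ∣
      ≤⟨ ℚP.+-mono-≤
           (ℚ*-mono (ℚP.0≤∣p∣ (x m)) (ℚP.<⇒≤ e′>0) (hB m (toNb ≤m)) (hy m n (toM ≤m) (toM ≤n)))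
           (ℚ*-mono (ℚP.0≤∣p∣ (y n)) (ℚP.<⇒≤ e′>0) (hC n (toNc ≤n)) (hx m n (toN ≤m) (toN ≤n))) ⟩
    B ℚ.* e′ ℚ.+ C ℚ.* e′
      ≡⟨ solve 4 (λ b c r e → b :* (r :* e) :+ c :* (r :* e) := (r :* (b :+ c)) :* e)
           refl B C (recip D) e ⟩
    (recip D ℚ.* D) ℚ.* e
      ≡⟨ cong (ℚ._* e) (recip-inverse D D>0) ⟩
    1ℚ ℚ.* e
      ≡⟨ ℚP.*-identityˡ e ⟩
    e ∎

inverse : (y : ℝ) → 0ℝ <ℝ y → ℝ
inverse (mkℝ y cy) (d , d>0 , N , y≥d) = mkℝ (λ n → recip (y n)) λ e e>0 →
  let c    = recip d
      c>0  = recip-pos d d>0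
      e′   = e ℚ.* (d ℚ.* d)
      e′>0 = 0<* e>0 (0<* d>0 d>0)
      M , h = cy e′ e′>0
      d≤ : ∀ {k} → N ℕ.≤ k → d ℚ.≤ y k
      d≤ {k} N≤k = subst (ℚ._≤ y k) (ℚP.+-identityˡ d) (y≥d k N≤k)
      y>0 : ∀ {k} → N ℕ.≤ k → 0ℚ ℚ.< y k
      y>0 N≤k = ℚP.<-≤-trans d>0 (d≤ N≤k)
      bound : ∀ {k} → N ℕ.≤ k → ∣ recip (y k) ∣ ℚ.≤ c
      bound {k} N≤k =
        let r = recip (y k)
            r>0 = recip-pos (y k) (y>0 N≤k)
            open ℚP.≤-Reasoning
        in begin
        ∣ r ∣                   ≡⟨ ℚP.0≤p⇒∣p∣≡p (ℚP.<⇒≤ r>0) ⟩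
        r                       ≡⟨ sym (ℚP.*-identityʳ r) ⟩
        r ℚ.* 1ℚ                ≡⟨ cong (r ℚ.*_) (sym (recip-inverse d d>0)) ⟩
        r ℚ.* (c ℚ.* d)         ≤⟨ ℚP.*-monoˡ-≤-nonNeg r {{ℚ.nonNegative (ℚP.<⇒≤ r>0)}}
                                     (ℚP.*-monoˡ-≤-nonNeg c {{ℚ.nonNegative (ℚP.<⇒≤ c>0)}} (d≤ N≤k)) ⟩
        r ℚ.* (c ℚ.* y k)       ≡⟨ solve 3 (λ r c y → r :* (c :* y) := (r :* y) :* c) refl r c (y k) ⟩
        (r ℚ.* y k) ℚ.* c       ≡⟨ cong (ℚ._* c) (recip-inverse (y k) (y>0 N≤k)) ⟩
        1ℚ ℚ.* c                ≡⟨ ℚP.*-identityˡ c ⟩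
        c ∎
  in N ⊔ M , λ m n ≤m ≤n →
    let N≤m = ℕP.m⊔n≤o⇒m≤o N M ≤m
        N≤n = ℕP.m⊔n≤o⇒m≤o N M ≤n
        M≤m = ℕP.m⊔n≤o⇒n≤o N M ≤m
        M≤n = ℕP.m⊔n≤o⇒n≤o N M ≤n
        a = recip (y m)
        b = recip (y n)
        open ℚP.≤-Reasoning
    in begin
    ∣ a ℚ.- b ∣
      ≡⟨ cong ∣_∣ (sym (cong₂ ℚ._-_ (ℚP.*-identityʳ a) (ℚP.*-identityʳ b))) ⟩
    ∣ a ℚ.* 1ℚ ℚ.- b ℚ.* 1ℚ ∣
      ≡⟨ cong₂ (λ u v → ∣ a ℚ.* u ℚ.- b ℚ.* v ∣)
           (sym (recip-inverse (y n) (y>0 N≤n))) (sym (recip-inverse (y m) (y>0 N≤m))) ⟩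
    ∣ a ℚ.* (b ℚ.* y n) ℚ.- b ℚ.* (a ℚ.* y m) ∣
      ≡⟨ cong ∣_∣ (solve 4 (λ a b u v → a :* (b :* v) :- b :* (a :* u) := (a :* b) :* (v :- u))
                    refl a b (y m) (y n)) ⟩
    ∣ (a ℚ.* b) ℚ.* (y n ℚ.- y m) ∣
      ≡⟨ trans (ℚP.∣p*q∣≡∣p∣*∣q∣ (a ℚ.* b) (y n ℚ.- y m))
               (cong (ℚ._* ∣ y n ℚ.- y m ∣) (ℚP.∣p*q∣≡∣p∣*∣q∣ a b)) ⟩
    (∣ a ∣ ℚ.* ∣ b ∣) ℚ.* ∣ y n ℚ.- y m ∣
      ≤⟨ ℚ*-mono (subst (ℚ._≤ ∣ a ∣ ℚ.* ∣ b ∣) (ℚP.*-zeroʳ ∣ a ∣)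
                  (ℚP.*-monoˡ-≤-nonNeg ∣ a ∣ {{ℚ.nonNegative (ℚP.0≤∣p∣ a)}} (ℚP.0≤∣p∣ b)))
                (ℚP.<⇒≤ e′>0)
                (ℚ*-mono (ℚP.0≤∣p∣ a) (ℚP.<⇒≤ c>0) (bound N≤m) (bound N≤n))
                (h n m M≤n M≤m) ⟩
    (c ℚ.* c) ℚ.* (e ℚ.* (d ℚ.* d))
      ≡⟨ solve 3 (λ c e d → (c :* c) :* (e :* (d :* d)) := (c :* d) :* ((c :* d) :* e)) refl c e d ⟩
    (c ℚ.* d) ℚ.* ((c ℚ.* d) ℚ.* e)
      ≡⟨ cong₂ (λ u v → u ℚ.* (v ℚ.* e)) (recip-inverse d d>0) (recip-inverse d d>0) ⟩
    1ℚ ℚ.* (1ℚ ℚ.* e)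
      ≡⟨ trans (ℚP.*-identityˡ _) (ℚP.*-identityˡ e) ⟩
    e ∎

infixl 7 _/ℝ_⟨_⟩ _÷ℕ_

_/ℝ_⟨_⟩ : ℝ → (y : ℝ) → 0ℝ <ℝ y → ℝ
x /ℝ y ⟨ y>0 ⟩ = x *ℝ inverse y y>0

-- Division by a natural number, with the convention x ÷ℕ 0 = 0.
_÷ℕ_ : ℝ → ℕ → ℝ
x ÷ℕ zero    = 0ℝ
x ÷ℕ (suc n) = x *ℝ fromℚ ((+ 1) ℚ./ suc n)

_^ℝ_ : ℝ → ℕ → ℝ
x ^ℝ zero    = 1ℝ
x ^ℝ (suc n) = x *ℝ (x ^ℝ n)

x<1⇒0<1-x : ∀ {x} → x <ℝ 1ℝ → 0ℝ <ℝ 1ℝ -ℝ x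
x<1⇒0<1-x {mkℝ x _} (d , d>0 , N , h) = d , d>0 , N , λ n N≤n →
  subst₂ ℚ._≤_
    (solve 2 (λ x d → (x :+ d) :+ (:- x) := con 0ℚ :+ d) refl (x n) d) refl
    (ℚP.+-monoˡ-≤ (ℚ.- x n) (h n N≤n))

*-positive : ∀ {x y} → 0ℝ <ℝ x → 0ℝ <ℝ y → 0ℝ <ℝ x *ℝ y
*-positive {mkℝ x _} {mkℝ y _} (c , c>0 , N , hx) (d , d>0 , M , hy) =
  c ℚ.* d , 0<* c>0 d>0 , N ⊔ M , λ n ≤n →
    let c≤x = subst (ℚ._≤ x n) (ℚP.+-identityˡ c) (hx n (ℕP.m⊔n≤o⇒m≤o N M ≤n))
        d≤y = subst (ℚ._≤ y n) (ℚP.+-identityˡ d) (hy n (ℕP.m⊔n≤o⇒n≤o N M ≤n))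
    in subst (ℚ._≤ x n ℚ.* y n) (sym (ℚP.+-identityˡ (c ℚ.* d)))
         (ℚ*-mono (ℚP.<⇒≤ c>0) (ℚP.≤-trans (ℚP.<⇒≤ d>0) d≤y) c≤x d≤y)

∑ : {A : Set} → List A → (A → ℝ) → ℝ
∑ []       g = 0ℝ
∑ (a ∷ as) g = g a +ℝ ∑ as g

IsRational : ℝ → Set
IsRational x = ∃ λ q → x ≃ fromℚ q

_⟶_ : (ℕ → ℝ) → ℝ → Set
a ⟶ x = ∀ e → 0ℚ ℚ.< e → ∃ λ N → ∀ n → N ℕ.≤ n →
  a n ≤ℝ x +ℝ fromℚ e × x ≤ℝ a n +ℝ fromℚ e

-- exp y = lim (1 + y/n)ⁿ, with n shifted by one to avoid division by 0.
IsExp : ℝ → ℝ → Set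
IsExp y x = (λ n → (1ℝ +ℝ y ÷ℕ suc n) ^ℝ suc n) ⟶ x

IsLn : ℝ → ℝ → Set
IsLn x y = IsExp y x

IsCeiling : ℝ → ℤ → Set
IsCeiling x z = x ≤ℝ fromℤ z × (∀ m → x ≤ℝ fromℤ m → z ℤ.≤ m)

-- Greatest lower bound; constructively a weaker requirement than an infimum
-- approximated by elements of S, so a weaker assumption on t.
IsInfimum : (ℝ → Set) → ℝ → Set
IsInfimum S t = (∀ s → S s → t ≤ℝ s) × (∀ b → (∀ s → S s → b ≤ℝ s) → b ≤ℝ t)

-- The edge family is a set of subsets, listed without repetition.
record Hypergraph : Set where
  field
    order         : ℕ
    edges         : List (Subset order)
    unique        : Unique edges
    edges≢[]      : edges ≢ []
    edgesNonempty : All Nonempty edges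

  Vertex : Set
  Vertex = Fin order

  Edge : Set
  Edge = Subset order

  vertices : List Vertex
  vertices = allFin order

  members : Edge → List Vertex
  members F = filter (_∈? F) vertices

  degree : Vertex → ℕ
  degree x = length (filter (x ∈?_) edges)

  maxDegree : ℕ
  maxDegree = max 0 (map degree vertices)

  -- A multiset of vertices is given by its multiplicity function.
  Multiset : Set
  Multiset = Vertex → ℕ

  size : Multiset → ℕ
  size A = sum (map A vertices)

  hits : Multiset → Edge → ℕ
  hits A F = sum (map A (members F))

  IsTransversal : ℕ → Multiset → Set
  IsTransversal f A = ∀ F → F ∈ᴸ edges → f ℕ.≤ hits A F

  IsTransversalNumber : ℕ → ℕ → Set
  IsTransversalNumber f t =
    (∃ λ A → IsTransversal f A × size A ≡ t) ×
    (∀ A → IsTransversal f A → t ℕ.≤ size A)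

  totalWeight : (Vertex → ℝ) → ℝ
  totalWeight w = ∑ vertices w

  IsFractionalTransversal : (Vertex → ℝ) → Set
  IsFractionalTransversal w =
    (∀ x → 0ℝ ≤ℝ w x × w x ≤ℝ 1ℝ) ×
    (∀ F → F ∈ᴸ edges → 1ℝ ≤ℝ ∑ (members F) w)

  IsFractionalTransversalNumber : ℝ → Set
  IsFractionalTransversalNumber =
    IsInfimum λ s → ∃ λ w → IsFractionalTransversal w × s ≃ totalWeight w

  multiplicity : List Vertex → Multiset
  multiplicity ps x = length (filter (x ≟_) ps)

  module Greedy (lam : ℝ) (f : ℕ) where

    value : Multiset → Vertex → ℝ
    value A x =
      ∑ (filter (λ F → hits A F ℕP.<? f) (filter (x ∈?_) edges))
        λ F → lam ^ℝ hits A F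

    -- The states reachable by the algorithm, as the list of picks made so
    -- far (latest first).  All ways of breaking ties are included.
    data Run : List Vertex → Set where
      start : Run []
      pick  : ∀ {ps} x → Run ps →
              ¬ IsTransversal f (multiplicity ps) →
              (∀ y → value (multiplicity ps) y ≤ℝ value (multiplicity ps) x) →
              Run (x ∷ ps)

    IsOutput : Multiset → Set
    IsOutput A = ∃ λ ps →
      Run ps × IsTransversal f (multiplicity ps) × (∀ x → A x ≡ multiplicity ps x)

{-# OPTIONS --safe #-}

-- Let w be a fractional transversal of weight W.  At any stage let v be the largest
-- value of a vertex, and let Ψ = Σ_F (λ^min(k(F),f) - λ^f).  Picking a vertex of value v
-- lowers Ψ by (1-λ)v, and Ψ ≤ Wv by double counting.  Writing 1 = v/v for every
-- pick and summing by parts, a run of m picks with values v₁ ≥ v₂ ≥ … and v₀ = Δ satisfies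
--   (1-λ) m ≤ W (1 + s),   s = Σ (1 - vᵢ₊₁/vᵢ) ≤ ln (Δ / v_m) ≤ ln Δ - f ln λ,
-- since λ^f ≤ v_m.  The hypotheses on λ and f turn this into m/f ≤ (1+ε) W.  Truncating
-- multiplicities at f makes A/f a fractional transversal for an optimal A; greedy
-- multiplicities never exceed f, because a picked vertex lies in an uncovered edge.
--
-- All of this is carried out over ℚ.  For real λ and w, terms of the Cauchy
-- sequences serve as rational λ and, slightly enlarged, as rational w; the
-- inequality s ≤ ln Δ - f ln λ is replaced by (1 + s/n)^n λ^f ≤ Δ for all n.

module Submission where

open import Algebra.Bundles using (CommutativeRing)
import Algebra.Properties.CommutativeSemigroup as CommutativeSemigroup
import Algebra.Properties.CommutativeSemiring.Exp as Exp
open import Data.Empty using (⊥; ⊥-elim)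
open import Data.Fin using (Fin) renaming (_≟_ to _≟ᶠ_)
open import Data.Fin.Subset using (_∈_)
open import Data.Fin.Subset.Properties using (_∈?_)
open import Data.Integer as ℤ using (+_; -[1+_])
import Data.Integer.Properties as ℤP
open import Data.List using (List; []; _∷_; map; filter; length)
import Data.List.Extrema as Extrema
import Data.List.Extrema.Nat as ℕE
import Data.List.Membership.DecPropositional as DecMembership
open import Data.List.Membership.Propositional using (find; lose) renaming (_∈_ to _∈ᴸ_)
open import Data.List.Membership.Propositional.Properties using (∈-allFin; ∈-filter⁺; ∈-filter⁻; ∈-map⁺)
open import Data.List.Properties using (filter-accept; filter-all; filter-none; filter-reject; filter-some; filter-≐; map-cong)
open import Data.List.Relation.Unary.All as All using (All; []; _∷_)
open import Data.List.Relation.Unary.AllPairs using ([]; _∷_)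
open import Data.List.Relation.Unary.Any using (any?; here; there)
open import Data.List.Relation.Unary.Unique.Propositional using (Unique)
import Data.List.Relation.Unary.Unique.Propositional.Properties as Unique
open import Data.Nat as ℕ using (ℕ; zero; suc)
open import Data.Nat.ListAction using (sum)
import Data.Nat.Properties as ℕP
open import Data.Product using (∃; _×_; _,_; proj₁; proj₂)
open import Data.Rational hiding (_≃_)
open import Data.Rational.Properties hiding (_≟_)
open import Data.Rational.Solver using (module +-*-Solver)
open import Data.Rational.Unnormalised as ℚᵘ using (mkℚᵘ; *≡*; *≤*)
import Data.Rational.Unnormalised.Properties as ℚᵘP
open import Data.Sum using (_⊎_; inj₁; inj₂)
open import Defs
open import Function using (_∘_)
open import Relation.Binary.Bundles using (DecTotalOrder)
open import Relation.Binary.PropositionalEquality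
open import Relation.Nullary using (Dec; ¬_; yes; no; contradiction)

open +-*-Solver using (solve; con; _:+_; _:*_; _:-_; :-_; _:=_)
open Exp (CommutativeRing.commutativeSemiring +-*-commutativeRing)
  using (_^_; ^-distrib-*; ^-assocʳ)
open CommutativeSemigroup ℕP.+-commutativeSemigroup using (interchange)
module ℚE = Extrema (DecTotalOrder.totalOrder ≤-decTotalOrder)

-- Rational arithmetic and the approximants (1 + x / n) ^ n of exp

-- The obstacle is that comparisons of reals cannot be decided. A largest value among reals cannot
-- be selected, so no greedy run is constructed for a real λ; one is constructed for each late
-- rational term of its Cauchy sequence. These runs may differ from term to term, but each has at
-- least `τ-f` picks, and this common bound is all that has to pass to the limit. Nor is there a
-- logarithm to apply: `IsLn` only says that certain powers converge. The upper bound on s therefore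
-- comes from one fixed n at which the approximant of exp at ln Δ - f ln λ + 2η, times λ^f, provably
-- exceeds Δ. Monotonicity of the power then caps s, and η is removed at the end. The constants in f
-- and in the condition on λ split ε evenly: after division by f (1 - λ), the term 1 + ln Δ costs at
-- most ε/2 and the term - f ln λ at most 1 + ε/2.

≤-by : ∀ {x y d} → 0ℚ ≤ d → x + d ≡ y → x ≤ y
≤-by {x} {y} {d} d≥0 eq =
  subst₂ _≤_ (+-identityʳ x) eq (+-monoʳ-≤ x d≥0)

<-by : ∀ {x y d} → 0ℚ < d → x + d ≡ y → x < y
<-by {x} {y} {d} d>0 eq =
  subst₂ _<_ (+-identityʳ x) eq (+-monoʳ-< x d>0)

-- Most inequalities below are proved by certificates: hypotheses become nonnegative terms through
-- `gap`, products and sums of these form the `d` of `≤-by`, and the ring solver checks the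
-- resulting identity.
gap : ∀ {x y} → x ≤ y → 0ℚ ≤ y - x
gap {x} {y} x≤y = subst (_≤ y - x) (+-inverseʳ x) (+-monoˡ-≤ (- x) x≤y)

gap< : ∀ {x y} → x < y → 0ℚ < y - x
gap< {x} {y} x<y = subst (_< y - x) (+-inverseʳ x) (+-monoˡ-< (- x) x<y)

0≤+ : ∀ {x y} → 0ℚ ≤ x → 0ℚ ≤ y → 0ℚ ≤ x + y
0≤+ {x} {y} x≥0 y≥0 = subst (_≤ x + y) (+-identityʳ 0ℚ) (+-mono-≤ x≥0 y≥0)

0<+ : ∀ {x y} → 0ℚ < x → 0ℚ ≤ y → 0ℚ < x + y
0<+ {x} {y} x>0 y≥0 = subst (_< x + y) (+-identityʳ 0ℚ) (+-mono-<-≤ x>0 y≥0)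

0≤* : ∀ {x y} → 0ℚ ≤ x → 0ℚ ≤ y → 0ℚ ≤ x * y
0≤* {x} {y} x≥0 y≥0 =
  subst (_≤ x * y) (*-zeroʳ x) (*-monoˡ-≤-nonNeg x {{nonNegative x≥0}} y≥0)

0<1 : 0ℚ < 1ℚ
0<1 = positive⁻¹ 1ℚ

0≤1 : 0ℚ ≤ 1ℚ
0≤1 = <⇒≤ 0<1

*-monoʳ : ∀ {x y z} → 0ℚ ≤ z → x ≤ y → x * z ≤ y * z
*-monoʳ {z = z} z≥0 = *-monoʳ-≤-nonNeg z {{nonNegative z≥0}}

*-monoˡ : ∀ {x y z} → 0ℚ ≤ z → x ≤ y → z * x ≤ z * y
*-monoˡ {z = z} z≥0 = *-monoˡ-≤-nonNeg z {{nonNegative z≥0}}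

*-mono : ∀ {x y z t} → 0ℚ ≤ x → 0ℚ ≤ z → x ≤ y → z ≤ t → x * z ≤ y * t
*-mono x≥0 z≥0 x≤y z≤t =
  ≤-trans (*-monoʳ z≥0 x≤y) (*-monoˡ (≤-trans x≥0 x≤y) z≤t)

*-cancelʳ : ∀ {x y z} → 0ℚ < z → x * z ≤ y * z → x ≤ y
*-cancelʳ {z = z} z>0 = *-cancelʳ-≤-pos z {{positive z>0}}

<⇒≱ : ∀ {x y} → x < y → ¬ y ≤ x
<⇒≱ x<y y≤x = <-irrefl refl (<-≤-trans x<y y≤x)

∣p∣≤⇒≤ : ∀ {x b} → ∣ x ∣ ≤ b → x ≤ b
∣p∣≤⇒≤ {x} ∣x∣≤b with ∣p∣≡p∨∣p∣≡-p x
... | inj₁ eq = subst (_≤ _) eq ∣x∣≤b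
... | inj₂ eq with ≤-total 0ℚ x
...   | inj₁ x≥0 = subst (_≤ _) (0≤p⇒∣p∣≡p x≥0) ∣x∣≤b
...   | inj₂ x≤0 = ≤-trans x≤0 (≤-trans (0≤∣p∣ x) ∣x∣≤b)

∣p∣≤⇒-≤ : ∀ {x b} → ∣ x ∣ ≤ b → - b ≤ x
∣p∣≤⇒-≤ {x} {b} ∣x∣≤b = subst (- b ≤_)
  (solve 1 (λ x → :- (:- x) := x) refl x)
  (neg-antimono-≤ (∣p∣≤⇒≤ (subst (_≤ b) (sym (∣-p∣≡∣p∣ x)) ∣x∣≤b)))

ι : ℕ → ℚ
ι n = + n / 1

toℚᵘ-ι : ∀ n → toℚᵘ (ι n) ℚᵘ.≃ mkℚᵘ (+ n) 0
toℚᵘ-ι n = toℚᵘ-fromℚᵘ (mkℚᵘ (+ n) 0)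

ι-+ : ∀ m n → ι (m ℕ.+ n) ≡ ι m + ι n
ι-+ m n = toℚᵘ-injective (ℚᵘP.≃-trans (toℚᵘ-ι (m ℕ.+ n))
  (ℚᵘP.≃-trans (*≡* (cong (ℤ._* + 1) (sym (cong₂ ℤ._+_ (ℤP.*-identityʳ (+ m)) (ℤP.*-identityʳ (+ n))))))
  (ℚᵘP.≃-sym (ℚᵘP.≃-trans (toℚᵘ-homo-+ (ι m) (ι n)) (ℚᵘP.+-cong (toℚᵘ-ι m) (toℚᵘ-ι n))))))

ι-suc : ∀ n → ι (suc n) ≡ 1ℚ + ι n
ι-suc = ι-+ 1

ι-mono : ∀ {m n} → m ℕ.≤ n → ι m ≤ ι n
ι-mono {m} {n} m≤n = toℚᵘ-cancel-≤ (ℚᵘP.≤-respˡ-≃ (ℚᵘP.≃-sym (toℚᵘ-ι m))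
  (ℚᵘP.≤-respʳ-≃ (ℚᵘP.≃-sym (toℚᵘ-ι n))
    (*≤* (ℤP.*-monoʳ-≤-nonNeg (+ 1) (ℤ.+≤+ m≤n)))))

0≤ι : ∀ n → 0ℚ ≤ ι n
0≤ι n = ι-mono {0} {n} ℕ.z≤n

ι*1/ : ∀ n → ι (suc n) * (+ 1 / suc n) ≡ 1ℚ
ι*1/ n = toℚᵘ-injective (ℚᵘP.≃-trans (toℚᵘ-homo-* (ι (suc n)) (+ 1 / suc n))
  (ℚᵘP.≃-trans (ℚᵘP.*-cong (toℚᵘ-ι (suc n)) (toℚᵘ-fromℚᵘ (mkℚᵘ (+ 1) n)))
    (*≡* (cong (λ k → + suc k) ([n*1]*1≡n+0+0 n)))))

  where
  [n*1]*1≡n+0+0 : ∀ n → (n ℕ.* 1) ℕ.* 1 ≡ n ℕ.+ 0 ℕ.+ 0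
  [n*1]*1≡n+0+0 n = trans (ℕP.*-identityʳ _) (trans (ℕP.*-identityʳ n) (sym (trans (ℕP.+-identityʳ _) (ℕP.+-identityʳ n))))

0<1/ : ∀ n → 0ℚ < + 1 / suc n
0<1/ n = positive⁻¹ (+ 1 / suc n) {{normalize-pos 1 (suc n)}}

1/≤1 : ∀ n → + 1 / suc n ≤ 1ℚ
1/≤1 n = ≤-by {d = ι n * (+ 1 / suc n)} (0≤* (0≤ι n) (<⇒≤ (0<1/ n)))
  (trans (solve 2 (λ h k → h :+ k :* h := (con 1ℚ :+ k) :* h) refl (+ 1 / suc n) (ι n))
    (trans (cong (_* (+ 1 / suc n)) (sym (ι-suc n))) (ι*1/ n)))

archimedean : ∀ p → ∃ λ n → p ≤ ι n
archimedean p@(mkℚ num d-1 _) = ℤ.∣ num ∣ , toℚᵘ-cancel-≤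
  (ℚᵘP.≤-respʳ-≃ (ℚᵘP.≃-sym (toℚᵘ-ι ℤ.∣ num ∣)) (*≤* (begin
    num ℤ.* + 1                  ≡⟨ ℤP.*-identityʳ num ⟩
    num                          ≤⟨ ≤∣∣ num ⟩
    + ℤ.∣ num ∣                  ≡⟨ ℤP.*-identityʳ _ ⟨
    + ℤ.∣ num ∣ ℤ.* + 1          ≤⟨ ℤP.*-monoˡ-≤-nonNeg (+ ℤ.∣ num ∣) (ℤ.+≤+ (ℕ.s≤s ℕ.z≤n)) ⟩
    + ℤ.∣ num ∣ ℤ.* + suc d-1    ∎)))
  where
  open ℤP.≤-Reasoning
  ≤∣∣ : ∀ z → z ℤ.≤ + ℤ.∣ z ∣
  ≤∣∣ (+ n)     = ℤP.≤-refl
  ≤∣∣ -[1+ n ]  = ℤ.-≤+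

0≤^ : ∀ {x} n → 0ℚ ≤ x → 0ℚ ≤ x ^ n
0≤^ zero    x≥0 = 0≤1
0≤^ (suc n) x≥0 = 0≤* x≥0 (0≤^ n x≥0)

0<^ : ∀ {x} n → 0ℚ < x → 0ℚ < x ^ n
0<^ zero    x>0 = 0<1
0<^ (suc n) x>0 = 0<* x>0 (0<^ n x>0)

^-monoˡ : ∀ {x y} n → 0ℚ ≤ x → x ≤ y → x ^ n ≤ y ^ n
^-monoˡ zero    x≥0 x≤y = ≤-refl
^-monoˡ (suc n) x≥0 x≤y = *-mono x≥0 (0≤^ n x≥0) x≤y (^-monoˡ n x≥0 x≤y)

1^ : ∀ n → 1ℚ ^ n ≡ 1ℚ
1^ zero    = refl
1^ (suc n) = trans (*-identityˡ _) (1^ n)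

^≤1 : ∀ {x} n → 0ℚ ≤ x → x ≤ 1ℚ → x ^ n ≤ 1ℚ
^≤1 {x} n x≥0 x≤1 = subst (x ^ n ≤_) (1^ n) (^-monoˡ n x≥0 x≤1)

^-antitone : ∀ {x m n} → 0ℚ ≤ x → x ≤ 1ℚ → m ℕ.≤ n → x ^ n ≤ x ^ m
^-antitone {n = n} x≥0 x≤1 ℕ.z≤n     = ^≤1 n x≥0 x≤1
^-antitone         x≥0 x≤1 (ℕ.s≤s p) = *-monoˡ x≥0 (^-antitone x≥0 x≤1 p)

^-swap : ∀ x m n → (x ^ m) ^ n ≡ (x ^ n) ^ m
^-swap x m n = trans (^-assocʳ x m n)
  (trans (cong (x ^_) (ℕP.*-comm m n)) (sym (^-assocʳ x n m)))

bernoulli : ∀ n {a} → 0ℚ ≤ 1ℚ + a → 1ℚ + ι n * a ≤ (1ℚ + a) ^ n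
bernoulli zero    {a} _ = ≤-reflexive (solve 1 (λ a → con 1ℚ :+ con 0ℚ :* a := con 1ℚ) refl a)
bernoulli (suc n) {a} 1+a≥0 = ≤-trans
  (≤-by (0≤* (0≤ι n) (square≥0 a))
    (trans (cong (λ k → 1ℚ + k * a + ι n * (a * a)) (ι-suc n))
      (solve 2 (λ a k → con 1ℚ :+ (con 1ℚ :+ k) :* a :+ k :* (a :* a)
                     := (con 1ℚ :+ a) :* (con 1ℚ :+ k :* a)) refl a (ι n))))
  (*-monoˡ 1+a≥0 (bernoulli n 1+a≥0))
  where
  square≥0 : ∀ a → 0ℚ ≤ a * a
  square≥0 a with ≤-total 0ℚ a
  ... | inj₁ a≥0 = 0≤* a≥0 a≥0
  ... | inj₂ a≤0 = subst (0ℚ ≤_) (solve 1 (λ a → (:- a) :* (:- a) := a :* a) refl a)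
                     (0≤* (neg-antimono-≤ a≤0) (neg-antimono-≤ a≤0))

-- exp a ≤ 1 / (1 - a), at the level of the approximants of exp.
exp-approx-upper : ∀ n {a} → 0ℚ ≤ a → a ≤ 1ℚ →
  (1ℚ + a * (+ 1 / suc n)) ^ suc n * (1ℚ - a) ≤ 1ℚ
exp-approx-upper n {a} a≥0 a≤1 = begin
  (1ℚ + b) ^ N * (1ℚ - a)          ≡⟨ cong (λ t → (1ℚ + b) ^ N * (1ℚ - t)) a≡Nb ⟩
  (1ℚ + b) ^ N * (1ℚ - ι N * b)    ≡⟨ cong ((1ℚ + b) ^ N *_)
                                        (solve 2 (λ k b → con 1ℚ :- k :* b := con 1ℚ :+ k :* (:- b)) refl (ι N) b) ⟩
  (1ℚ + b) ^ N * (1ℚ + ι N * - b)  ≤⟨ *-monoˡ (0≤^ N (0≤+ 0≤1 b≥0)) (bernoulli N (gap b≤1)) ⟩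
  (1ℚ + b) ^ N * (1ℚ - b) ^ N      ≡⟨ ^-distrib-* (1ℚ + b) (1ℚ - b) N ⟨
  ((1ℚ + b) * (1ℚ - b)) ^ N        ≤⟨ ^≤1 N (0≤* (0≤+ 0≤1 b≥0) (gap b≤1))
                                        (≤-by (0≤* b≥0 b≥0)
                                          (solve 1 (λ b → (con 1ℚ :+ b) :* (con 1ℚ :- b) :+ b :* b := con 1ℚ) refl b)) ⟩
  1ℚ ∎
  where
  open ≤-Reasoning
  N = suc n
  h = + 1 / suc n
  b = a * h
  b≥0 : 0ℚ ≤ b
  b≥0 = 0≤* a≥0 (<⇒≤ (0<1/ n))
  b≤1 : b ≤ 1ℚ
  b≤1 = ≤-trans (*-mono a≥0 (<⇒≤ (0<1/ n)) a≤1 (1/≤1 n)) (≤-reflexive (*-identityˡ 1ℚ))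
  a≡Nb : a ≡ ι N * b
  a≡Nb = trans (sym (*-identityʳ a)) (trans (cong (a *_) (sym (ι*1/ n)))
    (solve 3 (λ a k h → a :* (k :* h) := k :* (a :* h)) refl a (ι N) h))

-- Stands in for taking logarithms. The power is increasing in its exponent argument where the base
-- is nonnegative, so one `n` at which `t` overshoots `Δ` while `s` does not is enough.
exp-approx-cancel-≤ : ∀ n {s t c Δ} → 0ℚ ≤ c → 0ℚ ≤ 1ℚ + t * (+ 1 / suc n) →
  (1ℚ + s * (+ 1 / suc n)) ^ suc n * c ≤ Δ → Δ < (1ℚ + t * (+ 1 / suc n)) ^ suc n * c → s ≤ t
exp-approx-cancel-≤ n {s} {t} c≥0 t≥ s≤Δ Δ<t with ≤-total s t
... | inj₁ s≤t = s≤t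
... | inj₂ t≤s = contradiction
  (≤-trans (*-monoʳ c≥0 (^-monoˡ (suc n) t≥ (+-monoʳ-≤ 1ℚ (*-monoʳ (<⇒≤ (0<1/ n)) t≤s)))) s≤Δ)
  (<⇒≱ Δ<t)

-- By induction with κ halved: `d₂` solves (1 + d₂)(1 + κ/2) = 1 + κ. Needed to keep the effect on
-- λ^f of a relative error in λ under control.
^-near-1 : ∀ f κ → 0ℚ < κ → ∃ λ d → 0ℚ < d × (1ℚ + d) ^ f ≤ 1ℚ + κ
^-near-1 zero    κ κ>0 = 1ℚ , 0<1 , ≤-by (<⇒≤ κ>0) refl
^-near-1 (suc f) κ κ>0 =
  let κ′   = ½ * κ
      κ′>0 = 0<* (positive⁻¹ ½) κ>0
      d₁ , d₁>0 , h = ^-near-1 f κ′ κ′>0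
      t    = 1ℚ + κ′
      t>0  = 0<+ 0<1 (<⇒≤ κ′>0)
      d₂   = recip t * κ′
      d₂>0 = 0<* (recip-pos t t>0) κ′>0
      d    = d₁ ⊓ d₂
      d>0  = ⊓-pos d₁>0 d₂>0
  in d , d>0 , (begin
    (1ℚ + d) * (1ℚ + d) ^ f
      ≤⟨ *-mono (0≤+ 0≤1 (<⇒≤ d>0)) (0≤^ f (0≤+ 0≤1 (<⇒≤ d>0)))
           (+-monoʳ-≤ 1ℚ (p⊓q≤q d₁ d₂))
           (≤-trans (^-monoˡ f (0≤+ 0≤1 (<⇒≤ d>0)) (+-monoʳ-≤ 1ℚ (p⊓q≤p d₁ d₂))) h) ⟩
    (1ℚ + recip t * κ′) * t
      ≡⟨ solve 3 (λ r t k → (con 1ℚ :+ r :* k) :* t := t :+ (r :* t) :* k) refl (recip t) t κ′ ⟩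
    t + (recip t * t) * κ′
      ≡⟨ cong (λ u → t + u * κ′) (recip-inverse t t>0) ⟩
    1ℚ + ½ * κ + 1ℚ * (½ * κ)
      ≡⟨ solve 1 (λ k → con 1ℚ :+ con ½ :* k :+ con 1ℚ :* (con ½ :* k) := con 1ℚ :+ k) refl κ ⟩
    1ℚ + κ ∎)
  where
  open ≤-Reasoning
  ⊓-pos : ∀ {x y} → 0ℚ < x → 0ℚ < y → 0ℚ < x ⊓ y
  ⊓-pos {x} {y} x>0 y>0 with ≤-total x y
  ... | inj₁ x≤y = subst (0ℚ <_) (sym (p≤q⇒p⊓q≡p x≤y)) x>0
  ... | inj₂ y≤x = subst (0ℚ <_) (sym (p≥q⇒p⊓q≡q y≤x)) y>0

-- With h = 1/(n+1) and s = μ - f l + 2η this bounds exp s · λ^f from below by Δ,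
-- where exp μ = Δ and exp l = λ hold up to the error e.
exp-approx-lower : ∀ n f {μ l η q e d Δ} → let h = + 1 / suc n
                                               s = μ - ι f * l + (η + η) in
  0ℚ ≤ 1ℚ + μ * h → 0ℚ ≤ 1ℚ + l * h → 0ℚ ≤ 1ℚ + s * h →
  (μ * η - s * ι f * l) * h ≤ η → 0ℚ < η → η ≤ 1ℚ →
  (1ℚ + l * h) ^ suc n ≤ q + e → Δ ≤ (1ℚ + μ * h) ^ suc n + e →
  1ℚ ≤ Δ → 0ℚ ≤ q → e ≤ q * d → 0ℚ < d → (1ℚ + d) ^ f ≤ 1ℚ + ½ * η →
  e ≤ ½ * (½ * (½ * η)) →
  Δ < (1ℚ + s * h) ^ suc n * q ^ f
exp-approx-lower n f {μ} {l} {η} {q} {e} {d} {Δ}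
  μ≥ l≥ s≥ small η>0 η≤1 expl expμ Δ≥1 q≥0 e≤qd d>0 d-near e≤η = ≰⇒> λ X≤Δ →
  <⇒≱ η>0 (η≤0 X≤Δ)
  where
  open ≤-Reasoning
  h = + 1 / suc n
  N = suc n
  F = ι f
  s = μ - F * l + (η + η)
  P = (1ℚ + s * h) ^ N
  h≥0 : 0ℚ ≤ h
  h≥0 = <⇒≤ (0<1/ n)
  η≥0 = <⇒≤ η>0
  κ≥0 : 0ℚ ≤ 1ℚ + ½ * η
  κ≥0 = 0≤+ 0≤1 (0≤* (<⇒≤ 0<½) η≥0)
  P≥0 : 0ℚ ≤ P
  P≥0 = 0≤^ N s≥
  -- Of the two η in `s`, one pays for the factor 1 + η h on the left and the other, through
  -- `small`, for the terms of second order in `h`.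
  base : (1ℚ + μ * h) * (1ℚ + η * h) ≤ (1ℚ + s * h) * (1ℚ + l * h) ^ f
  base = begin
    (1ℚ + μ * h) * (1ℚ + η * h)
      ≤⟨ ≤-by (0≤* h≥0 (gap small))
           (solve 5 (λ μ η l F h → let s = μ :- F :* l :+ (η :+ η) in
              (con 1ℚ :+ μ :* h) :* (con 1ℚ :+ η :* h) :+ h :* (η :- (μ :* η :- s :* F :* l) :* h)
              := (con 1ℚ :+ s :* h) :* (con 1ℚ :+ F :* (l :* h))) refl μ η l F h) ⟩
    (1ℚ + s * h) * (1ℚ + F * (l * h))
      ≤⟨ *-monoˡ s≥ (bernoulli f l≥) ⟩
    (1ℚ + s * h) * (1ℚ + l * h) ^ f ∎
  Nη : ι N * (η * h) ≡ η
  Nη = trans (solve 3 (λ k η h → k :* (η :* h) := η :* (k :* h)) refl (ι N) η h)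
         (trans (cong (η *_) (ι*1/ n)) (*-identityʳ η))
  Δ-e≤ : Δ - e ≤ (1ℚ + μ * h) ^ N
  Δ-e≤ = ≤-by (gap expμ)
    (solve 3 (λ a b c → a :- b :+ (c :+ b :- a) := c) refl Δ e ((1ℚ + μ * h) ^ N))
  -- The N-th power of `base`. The gain 1 + η on the left has to outweigh the factor 1 + η/2 lost in
  -- replacing the approximant of exp l by `q`, and the error `e`.
  main : (Δ - e) * (1ℚ + η) ≤ (P * q ^ f) * (1ℚ + ½ * η)
  main = begin
    (Δ - e) * (1ℚ + η)
      ≤⟨ *-monoʳ (0≤+ 0≤1 η≥0) Δ-e≤ ⟩
    (1ℚ + μ * h) ^ N * (1ℚ + η)
      ≡⟨ cong (λ t → (1ℚ + μ * h) ^ N * (1ℚ + t)) Nη ⟨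
    (1ℚ + μ * h) ^ N * (1ℚ + ι N * (η * h))
      ≤⟨ *-monoˡ (0≤^ N μ≥) (bernoulli N (0≤+ 0≤1 (0≤* η≥0 h≥0))) ⟩
    (1ℚ + μ * h) ^ N * (1ℚ + η * h) ^ N
      ≡⟨ ^-distrib-* (1ℚ + μ * h) (1ℚ + η * h) N ⟨
    ((1ℚ + μ * h) * (1ℚ + η * h)) ^ N
      ≤⟨ ^-monoˡ N (0≤* μ≥ (0≤+ 0≤1 (0≤* η≥0 h≥0))) base ⟩
    ((1ℚ + s * h) * (1ℚ + l * h) ^ f) ^ N
      ≡⟨ ^-distrib-* (1ℚ + s * h) ((1ℚ + l * h) ^ f) N ⟩
    P * ((1ℚ + l * h) ^ f) ^ N
      ≡⟨ cong (P *_) (^-swap (1ℚ + l * h) f N) ⟩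
    P * ((1ℚ + l * h) ^ N) ^ f
      ≤⟨ *-monoˡ P≥0 (^-monoˡ f (0≤^ N l≥) (≤-trans expl (+-monoʳ-≤ q e≤qd))) ⟩
    P * (q + q * d) ^ f
      ≡⟨ cong (λ t → P * t ^ f) (solve 2 (λ q d → q :+ q :* d := q :* (con 1ℚ :+ d)) refl q d) ⟩
    P * (q * (1ℚ + d)) ^ f
      ≡⟨ cong (P *_) (^-distrib-* q (1ℚ + d) f) ⟩
    P * (q ^ f * (1ℚ + d) ^ f)
      ≤⟨ *-monoˡ P≥0 (*-monoˡ (0≤^ f q≥0) d-near) ⟩
    P * (q ^ f * (1ℚ + ½ * η))
      ≡⟨ *-assoc P (q ^ f) (1ℚ + ½ * η) ⟨
    (P * q ^ f) * (1ℚ + ½ * η) ∎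
  -- If P q^f ≤ Δ, then `main` gives Δ η/2 ≤ e (1 + η) ≤ η/4, by e ≤ η/8 and η ≤ 1. As Δ ≥ 1, this
  -- leaves η/4 ≤ 0.
  η≤0 : P * q ^ f ≤ Δ → η ≤ 0ℚ
  η≤0 X≤Δ = *-cancelʳ {z = ½ * ½} (positive⁻¹ (½ * ½)) (≤-by
    (0≤+ (0≤+ (0≤+ (gap main) (0≤* κ≥0 (gap X≤Δ))) (0≤* (0≤* (<⇒≤ 0<½) η≥0) (gap Δ≥1)))
         (0≤+ (0≤* (0≤+ 0≤1 η≥0) (gap e≤η)) (0≤* (0≤* {½ * (½ * ½)} (<⇒≤ (positive⁻¹ (½ * (½ * ½)))) η≥0) (gap η≤1))))
    (solve 4 (λ η D e X →
      η :* (con ½ :* con ½)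
      :+ (((X :* (con 1ℚ :+ con ½ :* η) :- (D :- e) :* (con 1ℚ :+ η))
           :+ (con 1ℚ :+ con ½ :* η) :* (D :- X)
           :+ (con ½ :* η) :* (D :- con 1ℚ))
          :+ ((con 1ℚ :+ η) :* (con ½ :* (con ½ :* (con ½ :* η)) :- e)
              :+ con (½ * (½ * ½)) :* η :* (con 1ℚ :- η)))
      := con 0ℚ :* (con ½ :* con ½)) refl η Δ e (P * q ^ f)))

-- Cauchy reals

Eventually : (ℕ → Set) → Set
Eventually P = ∃ λ N → ∀ n → N ℕ.≤ n → P n

ev-pure : {P : ℕ → Set} → (∀ n → P n) → Eventually P
ev-pure p = 0 , λ n _ → p n

ev-map : {P Q : ℕ → Set} → (∀ {n} → P n → Q n) → Eventually P → Eventually Q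
ev-map g (N , p) = N , λ n N≤n → g (p n N≤n)

infixr 4 _&_
_&_ : {P Q : ℕ → Set} → Eventually P → Eventually Q → Eventually (λ n → P n × Q n)
(N , p) & (M , q) = N ℕ.⊔ M , λ n ≤n →
  p n (ℕP.m⊔n≤o⇒m≤o N M ≤n) , q n (ℕP.m⊔n≤o⇒n≤o N M ≤n)

ev-all : {A : Set} {P : A → ℕ → Set} {xs : List A} →
  All (λ x → Eventually (P x)) xs → Eventually (λ n → All (λ x → P x n) xs)
ev-all []       = ev-pure λ _ → []
ev-all (p ∷ ps) = ev-map (λ (h , hs) → h ∷ hs) (p & ev-all ps)

-- The choice δ = e / (B + e) meets both bounds without a case distinction and makes sense for B =
-- 0.
small : ∀ {B e} → 0ℚ ≤ B → 0ℚ < e → ∃ λ δ → 0ℚ < δ × δ ≤ 1ℚ × δ * B ≤ e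
small {B} {e} B≥0 e>0 = δ , δ>0 , δ≤1 , ≤-by (0≤* (<⇒≤ δ>0) (<⇒≤ e>0))
    (trans (solve 3 (λ δ B e → δ :* B :+ δ :* e := δ :* (B :+ e)) refl δ B e) δT≡e)
  where
  T = B + e
  T>0 : 0ℚ < T
  T>0 = subst (_< T) (+-identityʳ 0ℚ) (+-mono-≤-< B≥0 e>0)
  δ = recip T * e
  δ>0 : 0ℚ < δ
  δ>0 = 0<* (recip-pos T T>0) e>0
  δT≡e : δ * T ≡ e
  δT≡e = trans (solve 3 (λ r e T → r :* e :* T := (r :* T) :* e) refl (recip T) e T)
           (trans (cong (_* e) (recip-inverse T T>0)) (*-identityˡ e))
  δ≤1 : δ ≤ 1ℚ
  δ≤1 = *-cancelʳ T>0 (≤-by B≥0 (trans (cong (_+ B) δT≡e)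
          (solve 2 (λ B e → e :+ B := con 1ℚ :* (B :+ e)) refl B e)))

bounded : ∀ x → ∃ λ B → 0ℚ < B × Eventually λ n → - B ≤ seq x n × seq x n ≤ B
bounded x = let B , B>0 , ev = eventual-bound (seq x) (cauchy x) in
  B , B>0 , ev-map (λ h → ∣p∣≤⇒-≤ h , ∣p∣≤⇒≤ h) ev

≤ℝ-eventually : ∀ {x y} → Eventually (λ n → seq x n ≤ seq y n) → x ≤ℝ y
≤ℝ-eventually {x} {y} ev e e>0 =
  ev-map (λ {n} h → ≤-trans h (≤-by (<⇒≤ e>0) refl)) ev

≤ℝ-pointwise : ∀ {x y} → (∀ n → seq x n ≡ seq y n) → x ≤ℝ y
≤ℝ-pointwise {x} {y} h = ≤ℝ-eventually {x} {y} (ev-pure λ n → ≤-reflexive (h n))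

≤ℝ-trans : ∀ {x y z} → x ≤ℝ y → y ≤ℝ z → x ≤ℝ z
≤ℝ-trans {x} {y} {z} x≤y y≤z e e>0 = ev-map
  (λ {n} (h , k) → ≤-trans h (≤-trans (+-monoˡ-≤ (½ * e) k)
    (≤-reflexive (solve 2 (λ z e → z :+ con ½ :* e :+ con ½ :* e := z :+ e) refl (seq z n) e))))
  (x≤y (½ * e) (0<* 0<½ e>0) & y≤z (½ * e) (0<* 0<½ e>0))

<⇒≤ℝ : ∀ {x y} → x <ℝ y → x ≤ℝ y
<⇒≤ℝ {x} {y} (e , e>0 , ev) =
  ≤ℝ-eventually {x} {y} (ev-map (λ h → ≤-trans (≤-by (<⇒≤ e>0) refl) h) ev)

<-≤ℝ-trans : ∀ {x y z} → x <ℝ y → y ≤ℝ z → x <ℝ z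
<-≤ℝ-trans {x} {y} {z} (e , e>0 , ev) y≤z =
  ½ * e , 0<* 0<½ e>0 , ev-map (λ {n} (h , k) → ≤-by (0≤+ (gap h) (gap k))
    (solve 4 (λ x y z e → x :+ con ½ :* e :+ ((y :- (x :+ e)) :+ (z :+ con ½ :* e :- y)) := z)
      refl (seq x n) (seq y n) (seq z n) e))
  (ev & y≤z (½ * e) (0<* 0<½ e>0))

≤-<ℝ-trans : ∀ {x y z} → x ≤ℝ y → y <ℝ z → x <ℝ z
≤-<ℝ-trans {x} {y} {z} x≤y (e , e>0 , ev) =
  ½ * e , 0<* 0<½ e>0 , ev-map (λ {n} (h , k) → ≤-by (0≤+ (gap h) (gap k))
    (solve 4 (λ x y z e → x :+ con ½ :* e :+ ((y :+ con ½ :* e :- x) :+ (z :- (y :+ e))) := z)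
      refl (seq x n) (seq y n) (seq z n) e))
  (x≤y (½ * e) (0<* 0<½ e>0) & ev)

+ℝ-mono : ∀ {x y z t} → x ≤ℝ y → z ≤ℝ t → x +ℝ z ≤ℝ y +ℝ t
+ℝ-mono {x} {y} {z} {t} x≤y z≤t e e>0 = ev-map
  (λ {n} (h , k) → ≤-by (0≤+ (gap h) (gap k))
    (solve 5 (λ x y z t e →
       x :+ z :+ ((y :+ con ½ :* e :- x) :+ (t :+ con ½ :* e :- z)) := y :+ t :+ e)
       refl (seq x n) (seq y n) (seq z n) (seq t n) e))
  (x≤y (½ * e) (0<* 0<½ e>0) & z≤t (½ * e) (0<* 0<½ e>0))

*ℝ-monoʳ : ∀ {x y z} → 0ℝ ≤ℝ z → x ≤ℝ y → x *ℝ z ≤ℝ y *ℝ z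
*ℝ-monoʳ {x} {y} {z} z≥0 x≤y e e>0 =
  let A , A>0 , evx = bounded x
      B , B>0 , evy = bounded y
      C , C>0 , evz = bounded z
      -- Both hypotheses hold only up to δ. Expanding (y + δ - x)(z + δ) ≥ 0 leaves the error δ (y -
      -- x + z + δ), and `D` bounds its second factor.
      D = A + B + C + 1ℚ
      D≥0 = 0≤+ (0≤+ (0≤+ (<⇒≤ A>0) (<⇒≤ B>0)) (<⇒≤ C>0)) 0≤1
      δ , δ>0 , δ≤1 , δD≤e = small D≥0 e>0
      δ≥0 = <⇒≤ δ>0
  in ev-map (λ {n} ((x≥ , _) , (_ , y≤) , (_ , z≤) , z≥0 , x≤y) →
       ≤-by (0≤+ (0≤+ (0≤* (gap x≤y) (gap z≥0)) (gap δD≤e))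
                 (0≤* δ≥0 (0≤+ (0≤+ (0≤+ (gap x≥) (gap y≤)) (gap z≤)) (gap δ≤1))))
         (solve 8 (λ x y z A B C δ e →
            x :* z :+ ((y :+ δ :- x) :* (z :+ δ :- con 0ℚ)
               :+ (e :- δ :* (A :+ B :+ C :+ con 1ℚ))
               :+ δ :* (x :- (:- A) :+ (B :- y) :+ (C :- z) :+ (con 1ℚ :- δ)))
            := y :* z :+ e) refl (seq x n) (seq y n) (seq z n) A B C δ e))
     (evx & evy & evz & z≥0 δ δ>0 & x≤y δ δ>0)

inverse-cancel : ∀ {x} y (y>0 : 0ℝ <ℝ y) →
  Eventually λ n → seq (x *ℝ inverse y y>0 *ℝ y) n ≡ seq x n
inverse-cancel {x} y (d , d>0 , ev) = ev-map (λ {n} h →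
    trans (*-assoc (seq x n) (recip (seq y n)) (seq y n))
      (trans (cong (seq x n *_) (recip-inverse (seq y n)
        (<-≤-trans (subst (0ℚ <_) (sym (+-identityˡ d)) d>0) h)))
        (*-identityʳ (seq x n)))) ev

inverse≥0 : ∀ y (y>0 : 0ℝ <ℝ y) → 0ℝ ≤ℝ inverse y y>0
inverse≥0 y y>0@(d , d>0 , ev) = ≤ℝ-eventually {0ℝ} {inverse y y>0} (ev-map (λ {n} h →
  <⇒≤ (recip-pos (seq y n) (<-≤-trans (subst (0ℚ <_) (sym (+-identityˡ d)) d>0) h))) ev)

/ℝ-≤⇒≤ℝ-* : ∀ {x y z} (y>0 : 0ℝ <ℝ y) → x /ℝ y ⟨ y>0 ⟩ ≤ℝ z → x ≤ℝ z *ℝ y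
/ℝ-≤⇒≤ℝ-* {x} {y} {z} y>0 h = ≤ℝ-trans {x} {x *ℝ inverse y y>0 *ℝ y} {z *ℝ y}
  (≤ℝ-eventually {x} {x *ℝ inverse y y>0 *ℝ y}
    (ev-map (λ eq → ≤-reflexive (sym eq)) (inverse-cancel {x} y y>0)))
  (*ℝ-monoʳ {x *ℝ inverse y y>0} {z} {y} (<⇒≤ℝ {0ℝ} {y} y>0) h)

*ℝ-inverse : ∀ {x} y (y>0 : 0ℝ <ℝ y) →
  Eventually λ n → seq (x *ℝ y *ℝ inverse y y>0) n ≡ seq x n
*ℝ-inverse {x} y y>0 = ev-map (λ {n} eq → trans
    (solve 3 (λ x r y → x :* y :* r := x :* r :* y) refl (seq x n) (recip (seq y n)) (seq y n)) eq)
  (inverse-cancel {x} y y>0)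

≤ℝ-*⇒/ℝ-≤ : ∀ {x y z} (y>0 : 0ℝ <ℝ y) → x ≤ℝ z *ℝ y → x /ℝ y ⟨ y>0 ⟩ ≤ℝ z
≤ℝ-*⇒/ℝ-≤ {x} {y} {z} y>0 h =
  ≤ℝ-trans {x *ℝ inverse y y>0} {z *ℝ y *ℝ inverse y y>0} {z}
    (*ℝ-monoʳ {x} {z *ℝ y} {inverse y y>0} (inverse≥0 y y>0) h)
    (≤ℝ-eventually {z *ℝ y *ℝ inverse y y>0} {z} (ev-map ≤-reflexive (*ℝ-inverse {z} y y>0)))

*ℝ-cancelʳ : ∀ {x y z} → 0ℝ <ℝ z → x *ℝ z ≤ℝ y *ℝ z → x ≤ℝ y
*ℝ-cancelʳ {x} {y} {z} z>0 h =
  ≤ℝ-trans {x} {x *ℝ z *ℝ inverse z z>0} {y}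
    (≤ℝ-eventually {x} {x *ℝ z *ℝ inverse z z>0} (ev-map (≤-reflexive ∘ sym) (*ℝ-inverse {x} z z>0)))
    (≤ℝ-*⇒/ℝ-≤ {x *ℝ z} {z} {y} z>0 h)

-- Removes the perturbation η: the product exceeds y z by η (y + z + η), which is arbitrarily small
-- because the terms of `y` and `z` are eventually bounded.
≤ℝ-*-limit : ∀ {x y z} →
  (∀ η → 0ℚ < η → η ≤ 1ℚ → x ≤ℝ (y +ℝ fromℚ η) *ℝ (z +ℝ fromℚ η)) → x ≤ℝ y *ℝ z
≤ℝ-*-limit {x} {y} {z} h e e>0 =
  let B , B>0 , evy = bounded y
      C , C>0 , evz = bounded z
      e′>0 = 0<* 0<½ e>0
      δ , δ>0 , δ≤1 , δD≤e = small (0≤+ (0≤+ (<⇒≤ B>0) (<⇒≤ C>0)) 0≤1) e′>0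
  in ev-map (λ {n} ((_ , y≤) , (_ , z≤) , x≤) →
       ≤-by (0≤+ (0≤+ (gap x≤) (gap δD≤e))
                 (0≤* (<⇒≤ δ>0) (0≤+ (0≤+ (gap y≤) (gap z≤)) (gap δ≤1))))
         (solve 7 (λ x y z B C δ e →
            x :+ (((y :+ δ) :* (z :+ δ) :+ con ½ :* e :- x)
              :+ (con ½ :* e :- δ :* (B :+ C :+ con 1ℚ))
              :+ δ :* (B :- y :+ (C :- z) :+ (con 1ℚ :- δ)))
            := y :* z :+ e) refl (seq x n) (seq y n) (seq z n) B C δ e))
     (evy & evz & h δ δ>0 δ≤1 (½ * e) e′>0)

-- Approximants of exp at the terms of a real

seq-^ : ∀ x n k → seq (x ^ℝ n) k ≡ seq x k ^ n
seq-^ x zero    k = refl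
seq-^ x (suc n) k = cong (seq x k *_) (seq-^ x n k)

seq-exp : ∀ y n k → seq ((1ℝ +ℝ y ÷ℕ suc n) ^ℝ suc n) k ≡ (1ℚ + seq y k * (+ 1 / suc n)) ^ suc n
seq-exp y n k = seq-^ (1ℝ +ℝ y ÷ℕ suc n) (suc n) k

0≤1+x/N : ∀ {x S} n → - S ≤ x → S ≤ ι (suc n) → 0ℚ ≤ 1ℚ + x * (+ 1 / suc n)
0≤1+x/N {x} {S} n x≥ N≥ = subst (0ℚ ≤_)
  (trans (solve 4 (λ x S h k → h :* ((x :- (:- S)) :+ (k :- S)) := k :* h :+ x :* h)
    refl x S (+ 1 / suc n) (ι (suc n)))
    (cong (_+ x * (+ 1 / suc n)) (ι*1/ n)))
  (0≤* (<⇒≤ (0<1/ n)) (0≤+ (gap x≥) (gap N≥)))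

-- Supplies the side conditions of `exp-approx-lower`. `S` bounds the absolute value of `s`, its
-- summand 2 absorbing 2η. The threshold for `n` depends on `μ` and `l` only through their bounds
-- `A` and `B`, so a single `n` serves all late terms of the two sequences.
approx-conditions : ∀ n F {A B η μ l} → let h = + 1 / suc n
                                            s = μ - F * l + (η + η)
                                            S = A + F * B + (1ℚ + 1ℚ) in
  0ℚ ≤ F → 0ℚ ≤ A → 0ℚ ≤ B → 0ℚ < η → η ≤ 1ℚ →
  - A ≤ μ → μ ≤ A → - B ≤ l → l ≤ B →
  S + B + recip η * (A + F * S * B) ≤ ι (suc n) →
  0ℚ ≤ 1ℚ + μ * h × 0ℚ ≤ 1ℚ + l * h × 0ℚ ≤ 1ℚ + s * h × (μ * η - s * F * l) * h ≤ η
approx-conditions n F {A} {B} {η} {μ} {l} F≥0 A≥0 B≥0 η>0 η≤1 μ≥ μ≤ l≥ l≤ N≥ =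
  0≤1+x/N n μ≥ (≤-trans S≥A N≥S) , 0≤1+x/N n l≥ N≥B , 0≤1+x/N n s≥ N≥S ,
  ≤-trans (*-monoʳ h≥0 s≤C) Ch≤η
  where
  h = + 1 / suc n
  s = μ - F * l + (η + η)
  S = A + F * B + (1ℚ + 1ℚ)
  C = A + F * S * B
  r = recip η
  h≥0 = <⇒≤ (0<1/ n)
  r≥0 = <⇒≤ (recip-pos η η>0)
  S≥A : A ≤ S
  S≥A = ≤-by (0≤+ (0≤* F≥0 B≥0) (0≤+ 0≤1 0≤1)) (sym (+-assoc A (F * B) _))
  S≥0 = ≤-trans A≥0 S≥A
  C≥0 = 0≤+ A≥0 (0≤* (0≤* F≥0 S≥0) B≥0)
  N≥S : S ≤ ι (suc n)
  N≥S = ≤-trans (≤-by (0≤+ B≥0 (0≤* r≥0 C≥0)) (sym (+-assoc S B _))) N≥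
  N≥B : B ≤ ι (suc n)
  N≥B = ≤-trans (≤-by (0≤+ S≥0 (0≤* r≥0 C≥0))
          (trans (sym (+-assoc B S _)) (cong (_+ r * C) (+-comm B S)))) N≥
  N≥rC : r * C ≤ ι (suc n)
  N≥rC = ≤-trans (≤-by (0≤+ S≥0 B≥0) (+-comm (r * C) (S + B))) N≥
  open ≤-Reasoning
  Ch≤η : C * h ≤ η
  Ch≤η = begin
    C * h                  ≡⟨ cong (_* h) (*-identityˡ C) ⟨
    1ℚ * C * h             ≡⟨ cong (λ u → u * C * h) (recip-inverse η η>0) ⟨
    r * η * C * h          ≡⟨ solve 4 (λ r η C h → r :* η :* C :* h := η :* (r :* C :* h)) refl r η C h ⟩
    η * (r * C * h)        ≤⟨ *-monoˡ (<⇒≤ η>0) (*-monoʳ h≥0 N≥rC) ⟩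
    η * (ι (suc n) * h)    ≡⟨ cong (η *_) (ι*1/ n) ⟩
    η * 1ℚ                 ≡⟨ *-identityʳ η ⟩
    η ∎
  s≥ : - S ≤ s
  s≥ = ≤-by (0≤+ (0≤+ (gap μ≥) (0≤* F≥0 (gap l≤))) (0≤+ (0≤+ 0≤1 0≤1) (0≤+ (<⇒≤ η>0) (<⇒≤ η>0))))
    (solve 6 (λ A B F μ l η →
      :- (A :+ F :* B :+ (con 1ℚ :+ con 1ℚ)) :+ ((μ :- (:- A) :+ F :* (B :- l)) :+ (con 1ℚ :+ con 1ℚ :+ (η :+ η)))
      := μ :- F :* l :+ (η :+ η)) refl A B F μ l η)
  s≤ : s ≤ S
  s≤ = ≤-by (0≤+ (0≤+ (gap μ≤) (0≤* F≥0 (gap l≥))) (0≤+ (gap η≤1) (gap η≤1)))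
    (solve 6 (λ A B F μ l η →
      μ :- F :* l :+ (η :+ η) :+ ((A :- μ :+ F :* (l :- (:- B))) :+ (con 1ℚ :- η :+ (con 1ℚ :- η)))
      := A :+ F :* B :+ (con 1ℚ :+ con 1ℚ)) refl A B F μ l η)
  -- Half of (S - s)(B - l) + (S + s)(B + l) equals S B + s l, so - s l ≤ S B needs no distinction
  -- of signs.
  product-bound : ∀ S s → - S ≤ s → s ≤ S → μ * η - s * F * l ≤ A + F * S * B
  product-bound S s s≥ s≤ = ≤-by (0≤+ (0≤+ (0≤* (<⇒≤ η>0) (gap μ≤)) (0≤* A≥0 (gap η≤1)))
                 (0≤* (0≤* (<⇒≤ 0<½) F≥0)
                   (0≤+ (0≤* (gap s≤) (gap l≤)) (0≤* (gap s≥) (gap l≥)))))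
    (solve 8 (λ A B S F μ l η s →
      μ :* η :- s :* F :* l :+ (η :* (A :- μ) :+ A :* (con 1ℚ :- η) :+
        con ½ :* F :* ((S :- s) :* (B :- l) :+ (s :- (:- S)) :* (l :- (:- B))))
      := A :+ F :* S :* B) refl A B S F μ l η s)
  s≤C : μ * η - s * F * l ≤ C
  s≤C = product-bound S s s≥ s≤

-- The order of choices matters: first the tolerance `e`, then `n` from the two limits, and only
-- then the late indices `k`. The overshoot 2η is what makes the last inequality strict in spite of
-- all approximation errors.
exp-ln-lower : ∀ M L lam Δ f η → IsExp M (fromℕ Δ) → IsExp L lam → 1 ℕ.≤ Δ → 0ℝ <ℝ lam →
  0ℚ < η → η ≤ 1ℚ → ∃ λ n → Eventually λ k →
    let t = 1ℚ + (seq M k - ι f * seq L k + (η + η)) * (+ 1 / suc n) in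
    0ℚ ≤ t × ι Δ < t ^ suc n * seq lam k ^ f
exp-ln-lower M L lam Δ f η expM expL Δ≥1 (q₀ , q₀>0 , evq) η>0 η≤1 =
  choose-N (bounded M) (bounded L) (choose-e (^-near-1 f (½ * η) κ>0))
  where
  κ>0 : 0ℚ < ½ * η
  κ>0 = 0<* 0<½ η>0
  Result : ℕ → ℕ → Set
  Result n k = let t = 1ℚ + (seq M k - ι f * seq L k + (η + η)) * (+ 1 / suc n) in
    0ℚ ≤ t × ι Δ < t ^ suc n * seq lam k ^ f
  -- The limit defining exp controls the absolute error `e`, but λ^f needs the relative error `d`;
  -- the lower bound `q₀` on the terms of λ converts one into the other.
  Tolerance : Set
  Tolerance = ∃ λ d → 0ℚ < d × (1ℚ + d) ^ f ≤ 1ℚ + ½ * η ×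
    ∃ λ e → 0ℚ < e × e ≤ q₀ * d × e ≤ ½ * (½ * (½ * η))
  choose-e : (∃ λ d → 0ℚ < d × (1ℚ + d) ^ f ≤ 1ℚ + ½ * η) → Tolerance
  choose-e (d , d>0 , d-near) with ≤-total (q₀ * d) (½ * (½ * (½ * η)))
  ... | inj₁ le = d , d>0 , d-near , q₀ * d , 0<* q₀>0 d>0 , ≤-refl , le
  ... | inj₂ ge = d , d>0 , d-near , ½ * (½ * (½ * η)) , 0<* 0<½ (0<* 0<½ κ>0) , ge , ≤-refl
  choose-N : (∃ λ A → 0ℚ < A × Eventually λ k → - A ≤ seq M k × seq M k ≤ A) →
             (∃ λ B → 0ℚ < B × Eventually λ k → - B ≤ seq L k × seq L k ≤ B) →
             Tolerance → ∃ λ n → Eventually (Result n)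
  choose-N (A , A>0 , evM) (B , B>0 , evL) (d , d>0 , d-near , e , e>0 , e≤qd , e≤η) =
    from-limits (expM (½ * e) (0<* 0<½ e>0)) (expL (½ * e) (0<* 0<½ e>0))
      (archimedean (S + B + recip η * (A + ι f * S * B)))
    where
    S = A + ι f * B + (1ℚ + 1ℚ)
    -- One half of `e` is spent on convergence in `n`, the other on passing from an inequality of
    -- reals to one of their terms.
    2halves : ∀ q → q + ½ * e + ½ * e ≡ q + e
    2halves q = trans (+-assoc q (½ * e) (½ * e)) (cong (λ t → q + t) (half+half e))
    from-limits :
      (∃ λ n₁ → ∀ n → n₁ ℕ.≤ n → (1ℝ +ℝ M ÷ℕ suc n) ^ℝ suc n ≤ℝ fromℕ Δ +ℝ fromℚ (½ * e)
        × fromℕ Δ ≤ℝ (1ℝ +ℝ M ÷ℕ suc n) ^ℝ suc n +ℝ fromℚ (½ * e)) →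
      (∃ λ n₂ → ∀ n → n₂ ℕ.≤ n → (1ℝ +ℝ L ÷ℕ suc n) ^ℝ suc n ≤ℝ lam +ℝ fromℚ (½ * e)
        × lam ≤ℝ (1ℝ +ℝ L ÷ℕ suc n) ^ℝ suc n +ℝ fromℚ (½ * e)) →
      (∃ λ n₃ → S + B + recip η * (A + ι f * S * B) ≤ ι n₃) → ∃ λ n → Eventually (Result n)
    from-limits (n₁ , hM) (n₂ , hL) (n₃ , n₃≥) = n , ev-map result
        (evM & evL & evq & proj₂ (hM n n₁≤n) (½ * e) (0<* 0<½ e>0)
             & proj₁ (hL n n₂≤n) (½ * e) (0<* 0<½ e>0))
      where
      n = n₁ ℕ.⊔ n₂ ℕ.⊔ n₃
      n₁≤n = ℕP.≤-trans (ℕP.m≤m⊔n n₁ n₂) (ℕP.m≤m⊔n (n₁ ℕ.⊔ n₂) n₃)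
      n₂≤n = ℕP.≤-trans (ℕP.m≤n⊔m n₁ n₂) (ℕP.m≤m⊔n (n₁ ℕ.⊔ n₂) n₃)
      n₃≤n = ℕP.m≤n⊔m (n₁ ℕ.⊔ n₂) n₃
      result : ∀ {k} → (- A ≤ seq M k × seq M k ≤ A) × (- B ≤ seq L k × seq L k ≤ B) ×
        seq 0ℝ k + q₀ ≤ seq lam k ×
        ι Δ ≤ seq ((1ℝ +ℝ M ÷ℕ suc n) ^ℝ suc n) k + ½ * e + ½ * e ×
        seq ((1ℝ +ℝ L ÷ℕ suc n) ^ℝ suc n) k ≤ seq lam k + ½ * e + ½ * e →
        Result n k
      result {k} ((μ≥ , μ≤) , (l≥ , l≤) , q≥ , Δ≤ , l-exp) =
        let c₁ , c₂ , c₃ , c₄ = approx-conditions n (ι f) (0≤ι f) (<⇒≤ A>0) (<⇒≤ B>0) η>0 η≤1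
              μ≥ μ≤ l≥ l≤ (≤-trans n₃≥ (ι-mono {n₃} {suc n} (ℕP.m≤n⇒m≤1+n n₃≤n)))
            q₀≤q = subst (_≤ seq lam k) (+-identityˡ q₀) q≥
        in c₃ , exp-approx-lower n f {seq M k} {seq L k} {η} {seq lam k} {e} {d} {ι Δ} c₁ c₂ c₃ c₄ η>0 η≤1
             (subst₂ _≤_ (seq-exp L n k) (2halves (seq lam k)) l-exp)
             (subst (ι Δ ≤_) (trans (2halves (seq ((1ℝ +ℝ M ÷ℕ suc n) ^ℝ suc n) k)) (cong (_+ e) (seq-exp M n k))) Δ≤)
             (ι-mono {1} {Δ} Δ≥1) (≤-trans (<⇒≤ q₀>0) q₀≤q)
             (≤-trans e≤qd (*-monoʳ (<⇒≤ d>0) q₀≤q)) d>0 d-near e≤η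

-- Finite sums

Σℚ : {A : Set} → List A → (A → ℚ) → ℚ
Σℚ []       g = 0ℚ
Σℚ (a ∷ as) g = g a + Σℚ as g

𝟙 : {P : Set} → Dec P → ℚ
𝟙 (yes _) = 1ℚ
𝟙 (no  _) = 0ℚ

0≤𝟙 : {P : Set} (P? : Dec P) → 0ℚ ≤ 𝟙 P?
0≤𝟙 (yes _) = 0≤1
0≤𝟙 (no  _) = ≤-refl

module _ {A : Set} where

  Σ-cong : ∀ (xs : List A) {g h : A → ℚ} → (∀ a → g a ≡ h a) → Σℚ xs g ≡ Σℚ xs h
  Σ-cong []       eq = refl
  Σ-cong (x ∷ xs) eq = cong₂ _+_ (eq x) (Σ-cong xs eq)

  Σ-mono : ∀ (xs : List A) {g h : A → ℚ} → (∀ a → a ∈ᴸ xs → g a ≤ h a) → Σℚ xs g ≤ Σℚ xs h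
  Σ-mono []       le = ≤-refl
  Σ-mono (x ∷ xs) le = +-mono-≤ (le x (here refl)) (Σ-mono xs λ a → le a ∘ there)

  0≤Σ : ∀ (xs : List A) {g : A → ℚ} → (∀ a → 0ℚ ≤ g a) → 0ℚ ≤ Σℚ xs g
  0≤Σ []       g≥0 = ≤-refl
  0≤Σ (x ∷ xs) g≥0 = 0≤+ (g≥0 x) (0≤Σ xs g≥0)

  Σ-zero : ∀ (xs : List A) → Σℚ xs (λ _ → 0ℚ) ≡ 0ℚ
  Σ-zero []       = refl
  Σ-zero (x ∷ xs) = trans (+-identityˡ _) (Σ-zero xs)

  Σ-+ : ∀ (xs : List A) (g h : A → ℚ) → Σℚ xs (λ a → g a + h a) ≡ Σℚ xs g + Σℚ xs h
  Σ-+ []       g h = refl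
  Σ-+ (x ∷ xs) g h = trans (cong (λ t → g x + h x + t) (Σ-+ xs g h))
    (solve 4 (λ a b c d → a :+ b :+ (c :+ d) := a :+ c :+ (b :+ d)) refl
      (g x) (h x) (Σℚ xs g) (Σℚ xs h))

  Σ-*ˡ : ∀ (xs : List A) c (g : A → ℚ) → Σℚ xs (λ a → c * g a) ≡ c * Σℚ xs g
  Σ-*ˡ []       c g = sym (*-zeroʳ c)
  Σ-*ˡ (x ∷ xs) c g = trans (cong (λ t → c * g x + t) (Σ-*ˡ xs c g))
    (sym (*-distribˡ-+ c (g x) (Σℚ xs g)))

  term≤Σ : ∀ {xs : List A} {a} {g : A → ℚ} → (∀ b → 0ℚ ≤ g b) → a ∈ᴸ xs → g a ≤ Σℚ xs g
  term≤Σ {x ∷ xs} {g = g} g≥0 (here refl) = ≤-by (0≤Σ xs g≥0) refl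
  term≤Σ {x ∷ xs} {g = g} g≥0 (there a∈) =
    ≤-trans (term≤Σ g≥0 a∈) (≤-by (g≥0 x) (+-comm _ (g x)))

  -- Indicators make the range of an inner sum independent of the outer variable, as the exchange of
  -- summations requires.
  Σ-filter : {P : A → Set} (P? : ∀ a → Dec (P a)) (xs : List A) (g : A → ℚ) →
    Σℚ (filter P? xs) g ≡ Σℚ xs (λ a → 𝟙 (P? a) * g a)
  Σ-filter P? []       g = refl
  Σ-filter P? (x ∷ xs) g with P? x
  ... | yes _ = cong₂ _+_ (sym (*-identityˡ (g x))) (Σ-filter P? xs g)
  ... | no  _ = trans (Σ-filter P? xs g)
                  (sym (trans (cong (λ t → t + _) (*-zeroˡ (g x))) (+-identityˡ _)))

  Σ-const : ∀ (xs : List A) c → Σℚ xs (λ _ → c) ≡ ι (length xs) * c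
  Σ-const []       c = sym (*-zeroˡ c)
  Σ-const (x ∷ xs) c = trans (cong (λ t → c + t) (Σ-const xs c))
    (trans (solve 2 (λ c k → c :+ k :* c := (con 1ℚ :+ k) :* c) refl c (ι (length xs)))
      (cong (_* c) (sym (ι-suc (length xs)))))

  Σ-ι : ∀ (xs : List A) (g : A → ℕ) → Σℚ xs (λ a → ι (g a)) ≡ ι (sum (map g xs))
  Σ-ι []       g = refl
  Σ-ι (x ∷ xs) g = trans (cong (λ t → ι (g x) + t) (Σ-ι xs g)) (sym (ι-+ (g x) _))

Σ-swap : {A B : Set} (xs : List A) (ys : List B) (g : A → B → ℚ) →
  Σℚ xs (λ a → Σℚ ys (g a)) ≡ Σℚ ys (λ b → Σℚ xs (λ a → g a b))
Σ-swap []       ys g = sym (Σ-zero ys)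
Σ-swap (x ∷ xs) ys g = trans (cong (λ t → Σℚ ys (g x) + t) (Σ-swap xs ys g))
  (sym (Σ-+ ys (g x) λ b → Σℚ xs λ a → g a b))

module _ {A : Set} where

  sum-map-≤ : ∀ (xs : List A) (g : A → ℕ) c → (∀ a → g a ℕ.≤ c) → sum (map g xs) ℕ.≤ length xs ℕ.* c
  sum-map-≤ []       g c le = ℕ.z≤n
  sum-map-≤ (x ∷ xs) g c le = ℕP.+-mono-≤ (le x) (sum-map-≤ xs g c le)

  sum-map-mono : ∀ (xs : List A) {g h : A → ℕ} → (∀ a → g a ℕ.≤ h a) → sum (map g xs) ℕ.≤ sum (map h xs)
  sum-map-mono []       le = ℕ.z≤n
  sum-map-mono (x ∷ xs) le = ℕP.+-mono-≤ (le x) (sum-map-mono xs le)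

  sum-map-zero : ∀ (xs : List A) → sum (map (λ _ → 0) xs) ≡ 0
  sum-map-zero []       = refl
  sum-map-zero (x ∷ xs) = sum-map-zero xs

  sum-map-+ : ∀ (xs : List A) (g h : A → ℕ) →
    sum (map (λ a → g a ℕ.+ h a) xs) ≡ sum (map g xs) ℕ.+ sum (map h xs)
  sum-map-+ []       g h = refl
  sum-map-+ (x ∷ xs) g h = trans (cong (λ t → g x ℕ.+ h x ℕ.+ t) (sum-map-+ xs g h))
    (interchange (g x) (h x) _ _)

  term≤sum-map : ∀ {xs : List A} {a} (g : A → ℕ) → a ∈ᴸ xs → g a ℕ.≤ sum (map g xs)
  term≤sum-map g (here refl) = ℕP.m≤m+n _ _
  term≤sum-map g (there a∈)  = ℕP.≤-trans (term≤sum-map g a∈) (ℕP.m≤n+m _ _)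

-- Counting occurrences in a list

module _ {n : ℕ} where

  open DecMembership (_≟ᶠ_ {n}) using () renaming (_∈?_ to _∈ᴸ?_)

  δ : Fin n → Fin n → ℕ
  δ p x = length (filter (x ≟ᶠ_) (p ∷ []))

  sum-δ-∉ : ∀ {p} (xs : List (Fin n)) → ¬ p ∈ᴸ xs → sum (map (δ p) xs) ≡ 0
  sum-δ-∉ []       p∉ = refl
  sum-δ-∉ {p} (x ∷ xs) p∉ with x ≟ᶠ p
  ... | yes refl = contradiction (here refl) p∉
  ... | no  _    = sum-δ-∉ xs (p∉ ∘ there)

  sum-δ-∈ : ∀ {p} {xs : List (Fin n)} → Unique xs → p ∈ᴸ xs → sum (map (δ p) xs) ≡ 1
  sum-δ-∈ {p} {x ∷ xs} (x≢ ∷ u) p∈ with x ≟ᶠ p | p∈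
  ... | yes refl | _         = cong suc (sum-δ-∉ xs λ p∈xs → All.lookup x≢ p∈xs refl)
  ... | no x≢p   | here refl = contradiction refl x≢p
  ... | no _     | there q∈  = sum-δ-∈ u q∈

  -- Each entry `p` of `ps` adds `δ p x` to the count of `x`. As `xs` has no repetitions, these
  -- contributions sum to 1 if `p` lies in `xs` and to 0 otherwise.
  sum-counts : ∀ {xs : List (Fin n)} → Unique xs → ∀ ps →
    sum (map (λ x → length (filter (x ≟ᶠ_) ps)) xs) ≡ length (filter (_∈ᴸ? xs) ps)
  sum-counts {xs} u []       = sum-map-zero xs
  sum-counts {xs} u (p ∷ ps) = trans
    (trans (cong sum (map-cong split xs)) (sum-map-+ xs (δ p) _))
    (trans (cong (sum (map (δ p) xs) ℕ.+_) (sum-counts u ps)) head)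
    where
    split : ∀ x → length (filter (x ≟ᶠ_) (p ∷ ps)) ≡ δ p x ℕ.+ length (filter (x ≟ᶠ_) ps)
    split x with x ≟ᶠ p
    ... | yes _ = refl
    ... | no  _ = refl
    head : sum (map (δ p) xs) ℕ.+ length (filter (_∈ᴸ? xs) ps) ≡ length (filter (_∈ᴸ? xs) (p ∷ ps))
    head with p ∈ᴸ? xs
    ... | yes p∈ = cong (ℕ._+ _) (sum-δ-∈ u p∈)
    ... | no  p∉ = cong (ℕ._+ _) (sum-δ-∉ xs p∉)

-- The greedy algorithm with rational λ

-- One step of the summation by parts. Scaling the old count by r = v′/v leaves r Ψ⁺ on the left;
-- the missing (1 - r) Ψ⁺ is at most (1 - r) v′ W, which is the origin of the increment 1 - r. The
-- drop from Ψ⁺ to Ψ accounts for the new pick.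
count-step : ∀ {k q v r W s Ψ} → let v′ = r * v ; Ψ⁺ = Ψ + (1ℚ - q) * v′ in
  0ℚ ≤ r → r ≤ 1ℚ → Ψ⁺ ≤ v′ * W → k * (1ℚ - q) * v + Ψ⁺ ≤ v * W * (1ℚ + s) →
  (1ℚ + k) * (1ℚ - q) * v′ + Ψ ≤ v′ * W * (1ℚ + (s + (1ℚ - r)))
count-step {k} {q} {v} {r} {W} {s} {Ψ} r≥0 r≤1 Ψ≤ count = ≤-by
  (0≤+ (0≤* r≥0 (gap count)) (0≤* (gap r≤1) (gap Ψ≤)))
  (solve 7 (λ k q v r W s P → let v′ = r :* v ; Q = P :+ (con 1ℚ :- q) :* v′ in
    (con 1ℚ :+ k) :* (con 1ℚ :- q) :* v′ :+ P
      :+ (r :* (v :* W :* (con 1ℚ :+ s) :- (k :* (con 1ℚ :- q) :* v :+ Q))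
          :+ (con 1ℚ :- r) :* (v′ :* W :- Q))
    := v′ :* W :* (con 1ℚ :+ (s :+ (con 1ℚ :- r)))) refl k q v r W s Ψ)

module _ (H : Hypergraph) where
  open Hypergraph H

  open DecMembership (_≟ᶠ_ {order}) using () renaming (_∈?_ to _∈ᴸ?_)

  hits-multiplicity : ∀ ps F → hits (multiplicity ps) F ≡ length (filter (_∈? F) ps)
  hits-multiplicity ps F = trans (sum-counts (Unique.filter⁺ (_∈? F) (Unique.allFin⁺ order)) ps)
    (cong length (filter-≐ (_∈ᴸ? members F) (_∈? F)
      ((λ x∈ → proj₂ (∈-filter⁻ (_∈? F) {xs = vertices} x∈)) , ∈-filter⁺ (_∈? F) (∈-allFin _)) ps))

  size-multiplicity : ∀ ps → size (multiplicity ps) ≡ length ps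
  size-multiplicity ps = trans (sum-counts (Unique.allFin⁺ order) ps)
    (cong length (filter-all (_∈ᴸ? vertices) {xs = ps} (All.tabulate λ _ → ∈-allFin _)))

  hits-cong : ∀ {A B} → (∀ x → A x ≡ B x) → ∀ F → hits A F ≡ hits B F
  hits-cong eq F = cong sum (map-cong eq (members F))

  transversal? : ∀ f A → Dec (IsTransversal f A)
  transversal? f A with All.all? (λ F → f ℕ.≤? hits A F) edges
  ... | yes all = yes λ F F∈ → All.lookup all F∈
  ... | no ¬all = no λ t → ¬all (All.tabulate λ {F} F∈ → t F F∈)

  uncovered : ∀ f A → ¬ IsTransversal f A → ∃ λ F → F ∈ᴸ edges × hits A F ℕ.< f
  uncovered f A ¬t with any? (λ F → hits A F ℕP.<? f) edges
  ... | yes some = find some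
  ... | no  none = contradiction (λ F F∈ → ℕP.≮⇒≥ λ lt → none (lose F∈ lt)) ¬t

  someEdge : ∃ λ F → F ∈ᴸ edges
  someEdge with edges | edges≢[]
  ... | []    | ≢[] = contradiction refl ≢[]
  ... | F ∷ _ | _   = F , here refl

  edgeVertex : ∀ {F} → F ∈ᴸ edges → ∃ λ x → x ∈ F
  edgeVertex F∈ = All.lookup edgesNonempty F∈

  someVertex : Vertex
  someVertex = proj₁ (edgeVertex (proj₂ someEdge))

  degree≤maxDegree : ∀ x → degree x ℕ.≤ maxDegree
  degree≤maxDegree x = All.lookup (ℕE.xs≤max 0 (map degree vertices)) (∈-map⁺ degree (∈-allFin x))

  1≤maxDegree : 1 ℕ.≤ maxDegree
  1≤maxDegree =
    let F , F∈  = someEdge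
        x , x∈F = edgeVertex F∈
    in ℕP.≤-trans (filter-some (x ∈?_) (lose F∈ x∈F)) (degree≤maxDegree x)

  module Core (f : ℕ) (q : ℚ) (q>0 : 0ℚ < q) (q<1 : q < 1ℚ) where

    q≥0 : 0ℚ ≤ q
    q≥0 = <⇒≤ q>0
    q≤1 : q ≤ 1ℚ
    q≤1 = <⇒≤ q<1

    valueℚ : Multiset → Vertex → ℚ
    valueℚ A x = Σℚ (filter (λ F → hits A F ℕP.<? f) (filter (x ∈?_) edges)) λ F → q ^ hits A F

    -- Comparisons of rational values are decidable, so a run of this kind can be constructed for
    -- every rational parameter.
    data Runℚ : List Vertex → Set where
      start : Runℚ []
      pick  : ∀ {ps} x → Runℚ ps → ¬ IsTransversal f (multiplicity ps) →
              (∀ y → valueℚ (multiplicity ps) y ≤ valueℚ (multiplicity ps) x) →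
              Runℚ (x ∷ ps)

    gain : ℕ → ℚ
    gain k = 𝟙 (k ℕP.<? f) * q ^ k

    -- For k ≤ f this is the geometric sum (1 - q)(q^k + ... + q^(f-1)): 1 - q times all the gain
    -- that the edge can still provide.
    deficit : ℕ → ℚ
    deficit k = q ^ (k ℕ.⊓ f) - q ^ f

    potential : Multiset → ℚ
    potential A = Σℚ edges λ F → deficit (hits A F)

    0≤gain : ∀ k → 0ℚ ≤ gain k
    0≤gain k = 0≤* (0≤𝟙 (k ℕP.<? f)) (0≤^ k q≥0)

    0≤deficit : ∀ k → 0ℚ ≤ deficit k
    0≤deficit k = gap (^-antitone q≥0 q≤1 (ℕP.m⊓n≤n k f))

    deficit≤gain : ∀ k → deficit k ≤ gain k
    deficit≤gain k with k ℕP.<? f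
    ... | yes k<f rewrite ℕP.m≤n⇒m⊓n≡m (ℕP.<⇒≤ k<f) =
      ≤-by (0≤^ f q≥0) (solve 2 (λ a b → a :- b :+ b := con 1ℚ :* a) refl (q ^ k) (q ^ f))
    ... | no  k≮f rewrite ℕP.m≥n⇒m⊓n≡n (ℕP.≮⇒≥ k≮f) =
      ≤-reflexive (trans (+-inverseʳ (q ^ f)) (sym (*-zeroˡ (q ^ k))))

    deficit-step : ∀ k → deficit (suc k) + (1ℚ - q) * gain k ≡ deficit k
    deficit-step k with k ℕP.<? f
    ... | yes k<f rewrite ℕP.m≤n⇒m⊓n≡m (ℕP.<⇒≤ k<f) | ℕP.m≤n⇒m⊓n≡m k<f =
      solve 3 (λ q a b → q :* a :- b :+ (con 1ℚ :- q) :* (con 1ℚ :* a) := a :- b) refl q (q ^ k) (q ^ f)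
    ... | no  k≮f rewrite ℕP.m≥n⇒m⊓n≡n (ℕP.≮⇒≥ k≮f) | ℕP.m≥n⇒m⊓n≡n (ℕP.m≤n⇒m≤1+n (ℕP.≮⇒≥ k≮f)) =
      solve 3 (λ q a b → b :- b :+ (con 1ℚ :- q) :* (con 0ℚ :* a) := b :- b) refl q (q ^ k) (q ^ f)

    gain-antitone : ∀ k → gain (suc k) ≤ gain k
    gain-antitone k with suc k ℕP.<? f | k ℕP.<? f
    ... | yes _    | yes _  = *-monoˡ 0≤1 (^-antitone q≥0 q≤1 (ℕP.n≤1+n k))
    ... | yes 1+k< | no k≮  = contradiction (ℕP.<-trans (ℕP.n<1+n k) 1+k<) k≮
    ... | no _     | k<f?   = ≤-trans (≤-reflexive (*-zeroˡ (q ^ suc k))) (0≤* (0≤𝟙 k<f?) (0≤^ k q≥0))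

    gain0≤1 : gain 0 ≤ 1ℚ
    gain0≤1 with 0 ℕP.<? f
    ... | yes _ = ≤-refl
    ... | no  _ = 0≤1

    value-gain : ∀ A x → valueℚ A x ≡ Σℚ edges λ F → 𝟙 (x ∈? F) * gain (hits A F)
    value-gain A x = trans (Σ-filter (λ F → hits A F ℕP.<? f) (filter (x ∈?_) edges) _)
      (Σ-filter (x ∈?_) edges _)

    hits-∈ : ∀ {x F} ps → x ∈ F → hits (multiplicity (x ∷ ps)) F ≡ suc (hits (multiplicity ps) F)
    hits-∈ {x} {F} ps x∈F = trans (hits-multiplicity (x ∷ ps) F)
      (trans (cong length (filter-accept (_∈? F) x∈F)) (cong suc (sym (hits-multiplicity ps F))))

    hits-∉ : ∀ {x F} ps → ¬ x ∈ F → hits (multiplicity (x ∷ ps)) F ≡ hits (multiplicity ps) F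
    hits-∉ {x} {F} ps x∉F = trans (hits-multiplicity (x ∷ ps) F)
      (trans (cong length (filter-reject (_∈? F) x∉F)) (sym (hits-multiplicity ps F)))

    potential-step : ∀ x ps → potential (multiplicity (x ∷ ps)) + (1ℚ - q) * valueℚ (multiplicity ps) x
                            ≡ potential (multiplicity ps)
    potential-step x ps = trans
      (cong₂ (λ a b → a + b) (refl {x = potential (multiplicity (x ∷ ps))})
        (trans (cong ((1ℚ - q) *_) (value-gain (multiplicity ps) x)) (sym (Σ-*ˡ edges (1ℚ - q) _))))
      (trans (sym (Σ-+ edges _ _)) (Σ-cong edges step))
      where
      step : ∀ F → deficit (hits (multiplicity (x ∷ ps)) F)
                   + (1ℚ - q) * (𝟙 (x ∈? F) * gain (hits (multiplicity ps) F))
                 ≡ deficit (hits (multiplicity ps) F)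
      step F with x ∈? F
      ... | yes x∈F = trans (cong₂ (λ k g → deficit k + (1ℚ - q) * g) (hits-∈ ps x∈F) (*-identityˡ (gain (hits (multiplicity ps) F))))
                        (deficit-step (hits (multiplicity ps) F))
      ... | no  x∉F = trans (cong₂ (λ k g → deficit k + (1ℚ - q) * g) (hits-∉ ps x∉F) (*-zeroˡ (gain (hits (multiplicity ps) F))))
                        (trans (cong (λ t → deficit (hits (multiplicity ps) F) + t) (*-zeroʳ (1ℚ - q))) (+-identityʳ _))

    value-antitone : ∀ x ps y → valueℚ (multiplicity (x ∷ ps)) y ≤ valueℚ (multiplicity ps) y
    value-antitone x ps y = subst₂ _≤_ (sym (value-gain _ y)) (sym (value-gain _ y))
      (Σ-mono edges λ F _ → *-monoˡ (0≤𝟙 (y ∈? F)) (gain≤ F))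
      where
      gain≤ : ∀ F → gain (hits (multiplicity (x ∷ ps)) F) ≤ gain (hits (multiplicity ps) F)
      gain≤ F with x ∈? F
      ... | yes x∈F rewrite hits-∈ ps x∈F = gain-antitone (hits (multiplicity ps) F)
      ... | no  x∉F rewrite hits-∉ ps x∉F = ≤-refl

    value-lower : ∀ A {x F} → F ∈ᴸ edges → x ∈ F → hits A F ℕ.< f → q ^ f ≤ valueℚ A x
    value-lower A {x} {F} F∈ x∈F k<f = ≤-trans (^-antitone q≥0 q≤1 (ℕP.<⇒≤ k<f))
      (term≤Σ {g = λ F → q ^ hits A F} (λ F → 0≤^ (hits A F) q≥0)
        (∈-filter⁺ (λ F → hits A F ℕP.<? f) (∈-filter⁺ (x ∈?_) F∈ x∈F) k<f))

    max-value-lower : ∀ A x → ¬ IsTransversal f A → (∀ y → valueℚ A y ≤ valueℚ A x) → q ^ f ≤ valueℚ A x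
    max-value-lower A x ¬t max =
      let F , F∈ , k<f = uncovered f A ¬t
          y , y∈F = edgeVertex F∈
      in ≤-trans (value-lower A F∈ y∈F k<f) (max y)

    value-initial : ∀ x → valueℚ (multiplicity []) x ≤ ι maxDegree
    value-initial x = begin
      valueℚ (multiplicity []) x
        ≡⟨ value-gain (multiplicity []) x ⟩
      Σℚ edges (λ F → 𝟙 (x ∈? F) * gain (hits (multiplicity []) F))
        ≤⟨ Σ-mono edges (λ F _ → *-monoˡ (0≤𝟙 (x ∈? F))
             (subst (λ k → gain k ≤ 1ℚ) (sym (hits-multiplicity [] F)) gain0≤1)) ⟩
      Σℚ edges (λ F → 𝟙 (x ∈? F) * 1ℚ)
        ≡⟨ Σ-filter (x ∈?_) edges (λ _ → 1ℚ) ⟨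
      Σℚ (filter (x ∈?_) edges) (λ _ → 1ℚ)
        ≡⟨ Σ-const (filter (x ∈?_) edges) 1ℚ ⟩
      ι (degree x) * 1ℚ
        ≡⟨ *-identityʳ _ ⟩
      ι (degree x)
        ≤⟨ ι-mono (degree≤maxDegree x) ⟩
      ι maxDegree ∎
      where open ≤-Reasoning

    multiplicity≤f : ∀ {ps} → Runℚ ps → ∀ x → multiplicity ps x ℕ.≤ f
    multiplicity≤f start                      x = ℕ.z≤n
    multiplicity≤f (pick {ps} y run ¬t max) x with x ≟ᶠ y
    ... | no  _    = multiplicity≤f run x
    ... | yes refl with any? (λ F → hits (multiplicity ps) F ℕP.<? f) (filter (x ∈?_) edges)
    ...   | yes some =
      let F , F∈ , k<f = find some
          x∈F = proj₂ (∈-filter⁻ (x ∈?_) {xs = edges} F∈)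
      in ℕP.≤-<-trans (term≤sum-map (multiplicity ps) (∈-filter⁺ (_∈? F) (∈-allFin x) x∈F)) k<f
    -- Without an uncovered edge through it, the picked vertex would have value 0, whereas the
    -- largest value is at least q^f > 0.
    ...   | no none = contradiction
      (≤-trans (max-value-lower (multiplicity ps) x ¬t max) (≤-reflexive value≡0))
      (<⇒≱ (0<^ f q>0))
      where
      value≡0 : valueℚ (multiplicity ps) x ≡ 0ℚ
      value≡0 = cong (λ Fs → Σℚ Fs λ F → q ^ hits (multiplicity ps) F)
        (filter-none (λ F → hits (multiplicity ps) F ℕP.<? f)
          (All.tabulate λ F∈ k<f → none (lose F∈ k<f)))

    -- No vertex is picked more than f times, so a run has at most f picks per vertex in total.
    -- Simulating one step beyond that number must have met a transversal.
    greedyRun : ∃ λ ps → Runℚ ps × IsTransversal f (multiplicity ps)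
    greedyRun with steps (suc (length vertices ℕ.* f))
      where
      steps : ∀ j → (∃ λ ps → Runℚ ps × IsTransversal f (multiplicity ps)) ⊎
                    (∃ λ ps → Runℚ ps × length ps ≡ j)
      steps zero    = inj₂ ([] , start , refl)
      steps (suc j) with steps j
      ... | inj₁ done = inj₁ done
      ... | inj₂ (ps , run , refl) with transversal? f (multiplicity ps)
      ...   | yes t = inj₁ (ps , run , t)
      ...   | no ¬t = inj₂ (_ , pick (ℚE.argmax (valueℚ (multiplicity ps)) someVertex vertices) run ¬t
                (λ y → All.lookup (ℚE.f[xs]≤f[argmax] {f = valueℚ (multiplicity ps)} someVertex vertices) (∈-allFin y)) , refl)
    ... | inj₁ done = done
    ... | inj₂ (ps , run , eq) = contradiction
      (subst (ℕ._≤ length vertices ℕ.* f) (trans (size-multiplicity ps) eq)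
        (sum-map-≤ vertices (multiplicity ps) f (multiplicity≤f run)))
      (ℕP.<⇒≱ (ℕP.n<1+n _))

    module _ (w : Vertex → ℚ) (w≥0 : ∀ x → 0ℚ ≤ w x)
             (cover : ∀ F → F ∈ᴸ edges → 1ℚ ≤ Σℚ (members F) w) where

      W : ℚ
      W = Σℚ vertices w

      -- Double counting of the pairs x ∈ F with weight w x · gain F.
      potential≤ : ∀ A v → (∀ x → valueℚ A x ≤ v) → potential A ≤ v * W
      potential≤ A v value≤ = begin
        Σℚ edges (λ F → deficit (hits A F))
          ≤⟨ Σ-mono edges (λ F F∈ → ≤-trans (deficit≤gain (hits A F))
               (≤-trans (≤-reflexive (sym (*-identityʳ _))) (*-monoˡ (0≤gain (hits A F)) (cover F F∈)))) ⟩
        Σℚ edges (λ F → gain (hits A F) * Σℚ (members F) w)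
          ≡⟨ Σ-cong edges (λ F → trans (cong (gain (hits A F) *_) (Σ-filter (_∈? F) vertices w))
               (sym (Σ-*ˡ vertices (gain (hits A F)) _))) ⟩
        Σℚ edges (λ F → Σℚ vertices λ x → gain (hits A F) * (𝟙 (x ∈? F) * w x))
          ≡⟨ Σ-swap edges vertices _ ⟩
        Σℚ vertices (λ x → Σℚ edges λ F → gain (hits A F) * (𝟙 (x ∈? F) * w x))
          ≡⟨ Σ-cong vertices (λ x → trans (Σ-cong edges λ F →
               solve 3 (λ g i w → g :* (i :* w) := w :* (i :* g)) refl (gain (hits A F)) (𝟙 (x ∈? F)) (w x))
               (trans (Σ-*ˡ edges (w x) _) (cong (w x *_) (sym (value-gain A x))))) ⟩
        Σℚ vertices (λ x → w x * valueℚ A x)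
          ≤⟨ Σ-mono vertices (λ x _ → *-monoˡ (w≥0 x) (value≤ x)) ⟩
        Σℚ vertices (λ x → w x * v)
          ≡⟨ Σ-cong vertices (λ x → *-comm (w x) v) ⟩
        Σℚ vertices (λ x → v * w x)
          ≡⟨ Σ-*ˡ vertices v w ⟩
        v * W ∎
        where open ≤-Reasoning

      -- v bounds the current values (it is the value of the last pick, or Δ), and
      -- s = Σ (1 - vᵢ₊₁ / vᵢ) ≤ ln (Δ / v), the latter through the approximants of exp.
      record Invariant (ps : List Vertex) : Set where
        field
          v s        : ℚ
          v>0        : 0ℚ < v
          q^f≤v      : q ^ f ≤ v
          s≥0        : 0ℚ ≤ s
          values≤v   : ∀ y → valueℚ (multiplicity ps) y ≤ v
          count      : ι (length ps) * (1ℚ - q) * v + potential (multiplicity ps) ≤ v * W * (1ℚ + s)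
          exp-s      : ∀ n → (1ℚ + s * (+ 1 / suc n)) ^ suc n * v ≤ ι maxDegree

      invariant-start : Invariant []
      invariant-start = record
        { v = ι maxDegree ; s = 0ℚ
        ; v>0 = <-≤-trans 0<1 Δ≥1
        ; q^f≤v = ≤-trans (^≤1 f q≥0 q≤1) Δ≥1
        ; s≥0 = ≤-refl
        ; values≤v = value-initial
        ; count = ≤-trans (≤-reflexive (trans
              (cong (_+ potential (multiplicity [])) (trans (cong (_* ι maxDegree) (*-zeroˡ (1ℚ - q))) (*-zeroˡ (ι maxDegree))))
              (+-identityˡ _)))
            (≤-trans (potential≤ (multiplicity []) (ι maxDegree) value-initial)
              (≤-reflexive (sym (*-identityʳ (ι maxDegree * W)))))
        ; exp-s = λ n → ≤-reflexive (trans (cong (_* ι maxDegree)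
            (trans (cong (λ t → (1ℚ + t) ^ suc n) (*-zeroˡ (+ 1 / suc n))) (1^ (suc n)))) (*-identityˡ (ι maxDegree)))
        }
        where
        Δ≥1 : 1ℚ ≤ ι maxDegree
        Δ≥1 = ι-mono {1} 1≤maxDegree

      invariant-step : ∀ {ps} x → Invariant ps → ¬ IsTransversal f (multiplicity ps) →
        (∀ y → valueℚ (multiplicity ps) y ≤ valueℚ (multiplicity ps) x) → Invariant (x ∷ ps)
      invariant-step {ps} x inv ¬t max = record
        { v = v′ ; s = s + a
        ; v>0 = <-≤-trans (0<^ f q>0) q^f≤v′
        ; q^f≤v = q^f≤v′
        ; s≥0 = 0≤+ s≥0 a≥0
        ; values≤v = λ y → ≤-trans (value-antitone x ps y) (max y)
        ; count = count′ v′ (potential (multiplicity ps)) (potential (multiplicity (x ∷ ps)))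
            v′≡rv (potential-step x ps) (potential≤ (multiplicity ps) v′ max) count
        ; exp-s = exp-s′
        }
        where
        open Invariant inv
        v′ = valueℚ (multiplicity ps) x
        r  = v′ * recip v
        a  = 1ℚ - r
        q^f≤v′ : q ^ f ≤ v′
        q^f≤v′ = max-value-lower (multiplicity ps) x ¬t max
        v′≡rv : v′ ≡ r * v
        v′≡rv = sym (trans (*-assoc v′ (recip v) v)
          (trans (cong (v′ *_) (recip-inverse v v>0)) (*-identityʳ v′)))
        r≥0 : 0ℚ ≤ r
        r≥0 = 0≤* (≤-trans (0≤^ f q≥0) q^f≤v′) (<⇒≤ (recip-pos v v>0))
        r≤1 : r ≤ 1ℚ
        r≤1 = *-cancelʳ v>0 (subst₂ _≤_ v′≡rv (sym (*-identityˡ v)) (values≤v x))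
        a≥0 : 0ℚ ≤ a
        a≥0 = gap r≤1
        a≤1 : a ≤ 1ℚ
        a≤1 = ≤-by r≥0 (solve 1 (λ r → con 1ℚ :- r :+ r := con 1ℚ) refl r)
        count′ : ∀ v′ Ψ Ψ′ → v′ ≡ r * v → Ψ′ + (1ℚ - q) * v′ ≡ Ψ → Ψ ≤ v′ * W →
          ι (length ps) * (1ℚ - q) * v + Ψ ≤ v * W * (1ℚ + s) →
          ι (suc (length ps)) * (1ℚ - q) * v′ + Ψ′ ≤ v′ * W * (1ℚ + (s + a))
        count′ _ _ Ψ′ refl refl Ψ≤ count rewrite ι-suc (length ps) =
          count-step {ι (length ps)} {q} {v} {r} {W} {s} {Ψ′} r≥0 r≤1 Ψ≤ count
        -- Raising `s` by `a` multiplies the approximant by at most 1 / (1 - a), and 1 - a = r is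
        -- exactly the factor by which `v` shrinks; hence the product does not grow.
        exp-s′ : ∀ n → (1ℚ + (s + a) * (+ 1 / suc n)) ^ suc n * v′ ≤ ι maxDegree
        exp-s′ n = begin
          (1ℚ + (s + a) * h) ^ N * v′
            ≤⟨ *-monoʳ (≤-trans (0≤^ f q≥0) q^f≤v′) (^-monoˡ N (0≤+ 0≤1 (0≤* (0≤+ s≥0 a≥0) h≥0)) product≥) ⟩
          ((1ℚ + s * h) * (1ℚ + a * h)) ^ N * v′
            ≡⟨ cong₂ _*_ (^-distrib-* (1ℚ + s * h) (1ℚ + a * h) N) v′≡rv ⟩
          (1ℚ + s * h) ^ N * (1ℚ + a * h) ^ N * (r * v)
            ≡⟨ solve 4 (λ A B r v → A :* B :* (r :* v) := (B :* (con 1ℚ :- (con 1ℚ :- r))) :* (A :* v)) refl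
                 ((1ℚ + s * h) ^ N) ((1ℚ + a * h) ^ N) r v ⟩
          ((1ℚ + a * h) ^ N * (1ℚ - a)) * ((1ℚ + s * h) ^ N * v)
            ≤⟨ *-monoʳ (0≤* (0≤^ N (0≤+ 0≤1 (0≤* s≥0 h≥0))) (<⇒≤ v>0)) (exp-approx-upper n a≥0 a≤1) ⟩
          1ℚ * ((1ℚ + s * h) ^ N * v)
            ≡⟨ *-identityˡ _ ⟩
          (1ℚ + s * h) ^ N * v
            ≤⟨ exp-s n ⟩
          ι maxDegree ∎
          where
          open ≤-Reasoning
          N = suc n
          h = + 1 / suc n
          h≥0 = <⇒≤ (0<1/ n)
          product≥ : 1ℚ + (s + a) * h ≤ (1ℚ + s * h) * (1ℚ + a * h)
          product≥ = ≤-by (0≤* (0≤* s≥0 h≥0) (0≤* a≥0 h≥0))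
            (solve 3 (λ s a h → con 1ℚ :+ (s :+ a) :* h :+ s :* h :* (a :* h)
                := (con 1ℚ :+ s :* h) :* (con 1ℚ :+ a :* h)) refl s a h)

      invariant : ∀ {ps} → Runℚ ps → Invariant ps
      invariant start             = invariant-start
      invariant (pick x run ¬t m) = invariant-step x (invariant run) ¬t m

      greedy-length : ∀ {ps} → Runℚ ps → ∃ λ s → 0ℚ ≤ s ×
        ι (length ps) * (1ℚ - q) ≤ W * (1ℚ + s) ×
        (∀ n → (1ℚ + s * (+ 1 / suc n)) ^ suc n * q ^ f ≤ ι maxDegree)
      greedy-length {ps} run = s , s≥0 ,
        *-cancelʳ v>0 (≤-trans (≤-by (0≤Σ edges λ F → 0≤deficit (hits (multiplicity ps) F)) refl)
          (≤-trans count (≤-reflexive (solve 3 (λ v W t → v :* W :* t := W :* t :* v) refl v W (1ℚ + s))))) ,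
        λ n → ≤-trans (*-monoˡ (0≤^ (suc n) (0≤+ 0≤1 (0≤* s≥0 (<⇒≤ (0<1/ n))))) q^f≤v) (exp-s n)
        where open Invariant (invariant run)

-- From rational to real λ and weights

seq-∑ : {A : Set} (xs : List A) (g : A → ℝ) → ∀ k → seq (∑ xs g) k ≡ Σℚ xs (λ a → seq (g a) k)
seq-∑ []       g k = refl
seq-∑ (x ∷ xs) g k = cong (λ t → seq (g x) k + t) (seq-∑ xs g k)

∑-mono : {A : Set} (xs : List A) {g h : A → ℝ} → (∀ a → g a ≤ℝ h a) → ∑ xs g ≤ℝ ∑ xs h
∑-mono []       le = ≤ℝ-pointwise {0ℝ} {0ℝ} λ _ → refl
∑-mono (x ∷ xs) {g} {h} le =
  +ℝ-mono {g x} {h x} {∑ xs g} {∑ xs h} (le x) (∑-mono xs {g} {h} le)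

0≤∑ : {A : Set} (xs : List A) {g : A → ℝ} → (∀ a → 0ℝ ≤ℝ g a) → 0ℝ ≤ℝ ∑ xs g
0≤∑ xs {g} g≥0 = ≤ℝ-trans {0ℝ} {∑ xs (λ _ → 0ℝ)} {∑ xs g}
  (≤ℝ-pointwise {0ℝ} {∑ xs (λ _ → 0ℝ)} λ k → sym (trans (seq-∑ xs _ k) (Σ-zero xs)))
  (∑-mono xs {λ _ → 0ℝ} {g} g≥0)

-ℝ-antitone : ∀ {x y} → x ≤ℝ y → -ℝ y ≤ℝ -ℝ x
-ℝ-antitone {x} {y} x≤y e e>0 = ev-map (λ {n} h → ≤-by (gap h)
  (solve 3 (λ x y e → :- y :+ (y :+ e :- x) := :- x :+ e) refl (seq x n) (seq y n) e)) (x≤y e e>0)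

^ℝ-mono : ∀ {x y} n → 0ℝ ≤ℝ x → x ≤ℝ y → x ^ℝ n ≤ℝ y ^ℝ n
^ℝ-mono             zero    x≥0 x≤y = ≤ℝ-pointwise {1ℝ} {1ℝ} λ _ → refl
^ℝ-mono {x} {y} (suc n) x≥0 x≤y =
  ≤ℝ-trans {x *ℝ x ^ℝ n} {y *ℝ x ^ℝ n} {y *ℝ y ^ℝ n}
    (*ℝ-monoʳ {x} {y} {x ^ℝ n} (0≤ℝ^ n) x≤y)
    (≤ℝ-trans {y *ℝ x ^ℝ n} {x ^ℝ n *ℝ y} {y *ℝ y ^ℝ n}
      (≤ℝ-pointwise {y *ℝ x ^ℝ n} {x ^ℝ n *ℝ y} λ k → *-comm (seq y k) _)
      (≤ℝ-trans {x ^ℝ n *ℝ y} {y ^ℝ n *ℝ y} {y *ℝ y ^ℝ n}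
        (*ℝ-monoʳ {x ^ℝ n} {y ^ℝ n} {y} (≤ℝ-trans {0ℝ} {x} {y} x≥0 x≤y) (^ℝ-mono {x} {y} n x≥0 x≤y))
        (≤ℝ-pointwise {y ^ℝ n *ℝ y} {y *ℝ y ^ℝ n} λ k → *-comm (seq (y ^ℝ n) k) (seq y k))))
  where
  0≤ℝ^ : ∀ n → 0ℝ ≤ℝ x ^ℝ n
  0≤ℝ^ zero    = ≤ℝ-eventually {0ℝ} {1ℝ} (ev-pure λ _ → 0≤1)
  0≤ℝ^ (suc n) = ≤ℝ-trans {0ℝ} {0ℝ *ℝ x ^ℝ n} {x *ℝ x ^ℝ n}
    (≤ℝ-pointwise {0ℝ} {0ℝ *ℝ x ^ℝ n} λ k → sym (*-zeroˡ (seq (x ^ℝ n) k)))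
    (*ℝ-monoʳ {0ℝ} {x} {x ^ℝ n} (0≤ℝ^ n) x≥0)

fromℚ-cancel-≤ : ∀ {p q} → fromℚ p ≤ℝ fromℚ q → p ≤ q
fromℚ-cancel-≤ {p} {q} h with p ≤? q
... | yes p≤q = p≤q
... | no  p≰q = let e>0 = 0<* 0<½ (gap< (≰⇒> p≰q)) ; N , hN = h (½ * (p - q)) e>0 in
  contradiction (≤-by (gap (hN N ℕP.≤-refl))
    (solve 2 (λ p q → con ½ :* (p :- q) :+ (q :+ con ½ :* (p :- q) :- p) := con 0ℚ) refl p q))
    (<⇒≱ e>0)

fromℚ-cancel-< : ∀ {p q} → fromℚ p <ℝ fromℚ q → p < q
fromℚ-cancel-< {p} {q} (e , e>0 , N , h) =
  <-≤-trans (<-by {d = e} e>0 refl) (h N ℕP.≤-refl)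

÷ℕ-mono : ∀ {a b} m → a ℕ.≤ b → fromℕ a ÷ℕ suc m ≤ℝ fromℕ b ÷ℕ suc m
÷ℕ-mono {a} {b} m a≤b = ≤ℝ-eventually {fromℕ a ÷ℕ suc m} {fromℕ b ÷ℕ suc m}
  (ev-pure λ _ → *-monoʳ (<⇒≤ (0<1/ m)) (ι-mono {a} {b} a≤b))

module _ (H : Hypergraph) where
  open Hypergraph H

  -- Below w is perturbed by δ so that a rational approximation of it becomes an exact
  -- nonnegative cover; this needs nonempty edges.
  rational-cover : ∀ (w : Vertex → ℚ) δ → 0ℚ ≤ δ → ∀ F → F ∈ᴸ edges →
    1ℚ ≤ Σℚ (members F) w + δ → 1ℚ ≤ Σℚ (members F) (λ x → w x + δ)
  rational-cover w δ δ≥0 F F∈ h = ≤-trans h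
    (≤-trans (+-monoʳ-≤ (Σℚ (members F) w)
      (let x , x∈F = edgeVertex H F∈
       in term≤Σ {g = λ _ → δ} (λ _ → δ≥0) (∈-filter⁺ (_∈? F) (∈-allFin x) x∈F)))
     (≤-reflexive (sym (Σ-+ (members F) w (λ _ → δ)))))

  rational-bound : ∀ f q (q>0 : 0ℚ < q) (q<1 : q < 1ℚ) (w : Vertex → ℚ) {n W⁺ s₀} N →
    (∀ x → 0ℚ ≤ w x) → (∀ F → F ∈ᴸ edges → 1ℚ ≤ Σℚ (members F) w) →
    (∃ λ ps → Core.Runℚ H f q q>0 q<1 ps × n ℕ.≤ length ps) →
    0ℚ ≤ 1ℚ + s₀ * (+ 1 / suc N) →
    ι maxDegree < (1ℚ + s₀ * (+ 1 / suc N)) ^ suc N * q ^ f →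
    Σℚ vertices w ≤ W⁺ → (1ℚ - q) * ι n ≤ W⁺ * (1ℚ + s₀)
  rational-bound f q q>0 q<1 w {n} {W⁺} {s₀} N w≥0 cover (ps , run , n≤) t≥0 Δ< W≤ =
    conclude (Core.greedy-length H f q q>0 q<1 w w≥0 cover run)
    where
    open ≤-Reasoning
    conclude : (∃ λ s → 0ℚ ≤ s × ι (length ps) * (1ℚ - q) ≤ Σℚ vertices w * (1ℚ + s) ×
        (∀ n → (1ℚ + s * (+ 1 / suc n)) ^ suc n * q ^ f ≤ ι maxDegree)) →
      (1ℚ - q) * ι n ≤ W⁺ * (1ℚ + s₀)
    conclude (s , s≥0 , count , exp-s) = begin
      (1ℚ - q) * ι n             ≤⟨ *-monoˡ (gap (<⇒≤ q<1)) (ι-mono n≤) ⟩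
      (1ℚ - q) * ι (length ps)   ≡⟨ *-comm (1ℚ - q) (ι (length ps)) ⟩
      ι (length ps) * (1ℚ - q)   ≤⟨ count ⟩
      Σℚ vertices w * (1ℚ + s)   ≤⟨ *-mono (0≤Σ vertices w≥0) (0≤+ 0≤1 s≥0) W≤ (+-monoʳ-≤ 1ℚ s≤s₀) ⟩
      W⁺ * (1ℚ + s₀) ∎
      where
      s≤s₀ : s ≤ s₀
      s≤s₀ = exp-approx-cancel-≤ N (0≤^ f (<⇒≤ q>0)) t≥0 (exp-s N) Δ<

  -- The run may change with `q`, so only a lower bound `n` on its length can be kept fixed along
  -- the terms of λ. The bounds on `q` are arguments because terms of λ satisfy them only
  -- eventually.
  GreedyLength≥ : ℕ → ℚ → ℕ → Set
  GreedyLength≥ f q n = (q>0 : 0ℚ < q) (q<1 : q < 1ℚ) →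
    ∃ λ ps → Core.Runℚ H f q q>0 q<1 ps × n ℕ.≤ length ps

  -- At a late index `k` the terms of λ, of the logarithms and of `w` + δ are admissible data for
  -- `rational-bound`. The perturbations raise the total weight and the exponent by at most η each,
  -- which `≤ℝ-*-limit` removes.
  weight-bound : ∀ lam M L f n (w : Vertex → ℝ) → 0ℝ <ℝ lam → lam <ℝ 1ℝ →
    IsExp M (fromℕ maxDegree) → IsExp L lam → IsFractionalTransversal w →
    Eventually (λ k → GreedyLength≥ f (seq lam k) n) →
    (1ℝ -ℝ lam) *ℝ fromℕ n ≤ℝ totalWeight w *ℝ (1ℝ +ℝ (M -ℝ fromℕ f *ℝ L))
  weight-bound lam M L f n w lam>0@(d₀ , d₀>0 , ev₀) lam<1@(d₁ , d₁>0 , ev₁) expM expL (w∈ , covers) runs =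
    ≤ℝ-*-limit {(1ℝ -ℝ lam) *ℝ fromℕ n} {totalWeight w} {1ℝ +ℝ (M -ℝ fromℕ f *ℝ L)} λ η η>0 η≤1 →
      perturbed η (small (0≤ι (length vertices)) η>0)
        -- `exp-ln-lower` overshoots by twice its parameter, hence the half of η.
        (exp-ln-lower M L lam maxDegree f (½ * η) expM expL (1≤maxDegree H) lam>0 (0<* 0<½ η>0)
          (≤-by (0≤+ (gap η≤1) (0≤* (<⇒≤ 0<½) (<⇒≤ η>0)))
            (solve 1 (λ η → con ½ :* η :+ (con 1ℚ :- η :+ con ½ :* η) := con 1ℚ) refl η)))
    where
    module _ (η : ℚ) where
      s₀ : ℕ → ℚ
      s₀ k = seq M k - ι f * seq L k + (½ * η + ½ * η)
      perturbed :
        (∃ λ δ → 0ℚ < δ × δ ≤ 1ℚ × δ * ι (length vertices) ≤ η) →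
        (∃ λ N → Eventually λ k → 0ℚ ≤ 1ℚ + s₀ k * (+ 1 / suc N) ×
          ι maxDegree < (1ℚ + s₀ k * (+ 1 / suc N)) ^ suc N * seq lam k ^ f) →
        (1ℝ -ℝ lam) *ℝ fromℕ n ≤ℝ (totalWeight w +ℝ fromℚ η) *ℝ (1ℝ +ℝ (M -ℝ fromℕ f *ℝ L) +ℝ fromℚ η)
      perturbed (δ , δ>0 , _ , δX≤η) (N , exps) = ≤ℝ-eventually
        {(1ℝ -ℝ lam) *ℝ fromℕ n} {(totalWeight w +ℝ fromℚ η) *ℝ (1ℝ +ℝ (M -ℝ fromℕ f *ℝ L) +ℝ fromℚ η)}
        (ev-map at-index (ev₀ & ev₁
          -- There are finitely many vertices and edges, so all constraints on `w` hold
          -- simultaneously from some index on.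
          & ev-all {P = λ x k → 0ℚ ≤ seq (w x) k + δ} {vertices}
              (All.tabulate λ {x} _ → proj₁ (w∈ x) δ δ>0)
          & ev-all {P = λ F k → 1ℚ ≤ seq (∑ (members F) w) k + δ} {edges}
              (All.tabulate λ {F} F∈ → covers F F∈ δ δ>0)
          & exps & runs))
        where
        at-index : ∀ {k} → seq 0ℝ k + d₀ ≤ seq lam k × seq lam k + d₁ ≤ seq 1ℝ k ×
          All (λ x → 0ℚ ≤ seq (w x) k + δ) vertices ×
          All (λ F → 1ℚ ≤ seq (∑ (members F) w) k + δ) edges ×
          (0ℚ ≤ 1ℚ + s₀ k * (+ 1 / suc N) ×
            ι maxDegree < (1ℚ + s₀ k * (+ 1 / suc N)) ^ suc N * seq lam k ^ f) ×
          GreedyLength≥ f (seq lam k) n →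
          seq ((1ℝ -ℝ lam) *ℝ fromℕ n) k ≤
          seq ((totalWeight w +ℝ fromℚ η) *ℝ (1ℝ +ℝ (M -ℝ fromℕ f *ℝ L) +ℝ fromℚ η)) k
        at-index {k} (q≥ , q≤ , nonneg , cover , (t≥0 , Δ<) , run) = subst
          (λ z → (1ℚ - seq lam k) * ι n ≤ (seq (totalWeight w) k + η) * z)
          (solve 4 (λ M F L η → con 1ℚ :+ (M :- F :* L :+ (con ½ :* η :+ con ½ :* η))
             := con 1ℚ :+ (M :- F :* L) :+ η) refl (seq M k) (ι f) (seq L k) η)
          (rational-bound f (seq lam k) q>0 q<1 w′ {n} {seq (totalWeight w) k + η} {s₀ k} N (λ x → All.lookup nonneg (∈-allFin x))
            (λ F F∈ → rational-cover (λ x → seq (w x) k) δ (<⇒≤ δ>0) F F∈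
              (subst (λ t → 1ℚ ≤ t + δ) (seq-∑ (members F) w k) (All.lookup cover F∈)))
            (run q>0 q<1) t≥0 Δ< W′≤)
          where
          open ≤-Reasoning
          q>0 : 0ℚ < seq lam k
          q>0 = <-≤-trans (<-by d₀>0 refl) q≥
          q<1 : seq lam k < 1ℚ
          q<1 = <-≤-trans (<-by d₁>0 refl) q≤
          w′ : Vertex → ℚ
          w′ x = seq (w x) k + δ
          W′≤ : Σℚ vertices w′ ≤ seq (totalWeight w) k + η
          W′≤ = begin
            Σℚ vertices w′
              ≡⟨ Σ-+ vertices (λ x → seq (w x) k) (λ _ → δ) ⟩
            Σℚ vertices (λ x → seq (w x) k) + Σℚ vertices (λ _ → δ)
              ≡⟨ cong₂ _+_ (sym (seq-∑ vertices w k))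
                   (trans (Σ-const vertices δ) (*-comm (ι (length vertices)) δ)) ⟩
            seq (totalWeight w) k + δ * ι (length vertices)
              ≤⟨ +-monoʳ-≤ (seq (totalWeight w) k) δX≤η ⟩
            seq (totalWeight w) k + η ∎

-- Each hypothesis uses half of ε: the one on λ gives - f L ≤ f (1 + ε/2) c, the one on f gives 1 +
-- M ≤ f (ε/2) c, where c is 1 - λ.
exponent-bound : ∀ {M L ε c} f →
  -ℝ L ≤ℝ (1ℝ +ℝ ε ÷ℕ 2) *ℝ c → fromℕ 2 *ℝ (1ℝ +ℝ M) ≤ℝ fromℕ f *ℝ (ε *ℝ c) →
  1ℝ +ℝ (M -ℝ fromℕ f *ℝ L) ≤ℝ fromℕ f *ℝ (1ℝ +ℝ ε) *ℝ c
exponent-bound {M} {L} {ε} {c} f hL hM e e>0 =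
  let e′>0 = 0<* 0<½ e>0
      δ , δ>0 , _ , δf≤e = small (0≤ι f) e′>0
  in ev-map (λ {k} (l , m) → certificate k (ι f) δ (0≤ι f) l m δf≤e) (hL δ δ>0 & hM e e>0)
  where
  certificate : ∀ k F δ → 0ℚ ≤ F → - seq L k ≤ (1ℚ + seq ε k * ½) * seq c k + δ →
    (1ℚ + 1ℚ) * (1ℚ + seq M k) ≤ F * (seq ε k * seq c k) + e → δ * F ≤ ½ * e →
    1ℚ + (seq M k - F * seq L k) ≤ F * (1ℚ + seq ε k) * seq c k + e
  certificate k F δ F≥0 l m δF = ≤-by
    (0≤+ (0≤+ (0≤* F≥0 (gap l)) (0≤* (<⇒≤ 0<½) (gap m))) (gap δF))
    (solve 7 (λ M L E c F δ e →
      con 1ℚ :+ (M :- F :* L) :+ (F :* ((con 1ℚ :+ E :* con ½) :* c :+ δ :- (:- L))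
        :+ con ½ :* (F :* (E :* c) :+ e :- (con 1ℚ :+ con 1ℚ) :* (con 1ℚ :+ M))
        :+ (con ½ :* e :- δ :* F))
      := F :* (con 1ℚ :+ E) :* c :+ e) refl (seq M k) (seq L k) (seq ε k) (seq c k) F δ e)

scale-bound : ∀ {W Z ε c} m n → 0ℝ <ℝ c → 0ℝ ≤ℝ W →
  c *ℝ fromℕ n ≤ℝ W *ℝ Z → Z ≤ℝ fromℕ (suc m) *ℝ (1ℝ +ℝ ε) *ℝ c →
  fromℕ n ÷ℕ suc m ≤ℝ W *ℝ (1ℝ +ℝ ε)
scale-bound {W} {Z} {ε} {c} m n c>0 W≥0 h hZ =
  ≤ℝ-trans {fromℕ n ÷ℕ suc m} {(W *ℝ (1ℝ +ℝ ε) *ℝ f) *ℝ fromℚ (+ 1 / suc m)} {W *ℝ (1ℝ +ℝ ε)}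
    (*ℝ-monoʳ {fromℕ n} {W *ℝ (1ℝ +ℝ ε) *ℝ f} {fromℚ (+ 1 / suc m)}
      (≤ℝ-eventually {0ℝ} {fromℚ (+ 1 / suc m)} (ev-pure λ _ → <⇒≤ (0<1/ m)))
      (*ℝ-cancelʳ {fromℕ n} {W *ℝ (1ℝ +ℝ ε) *ℝ f} {c} c>0 nc≤))
    (≤ℝ-pointwise {(W *ℝ (1ℝ +ℝ ε) *ℝ f) *ℝ fromℚ (+ 1 / suc m)} {W *ℝ (1ℝ +ℝ ε)} λ k →
      trans (*-assoc (seq W k * (1ℚ + seq ε k)) (ι (suc m)) (+ 1 / suc m))
        (trans (cong (seq W k * (1ℚ + seq ε k) *_) (ι*1/ m)) (*-identityʳ _)))
  where
  f = fromℕ (suc m)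
  B = f *ℝ (1ℝ +ℝ ε) *ℝ c
  nc≤ : fromℕ n *ℝ c ≤ℝ W *ℝ (1ℝ +ℝ ε) *ℝ f *ℝ c
  nc≤ = ≤ℝ-trans {fromℕ n *ℝ c} {c *ℝ fromℕ n} {W *ℝ (1ℝ +ℝ ε) *ℝ f *ℝ c}
    (≤ℝ-pointwise {fromℕ n *ℝ c} {c *ℝ fromℕ n} λ k → *-comm (ι n) (seq c k))
    (≤ℝ-trans {c *ℝ fromℕ n} {W *ℝ Z} {W *ℝ (1ℝ +ℝ ε) *ℝ f *ℝ c} h
    (≤ℝ-trans {W *ℝ Z} {Z *ℝ W} {W *ℝ (1ℝ +ℝ ε) *ℝ f *ℝ c}
      (≤ℝ-pointwise {W *ℝ Z} {Z *ℝ W} λ k → *-comm (seq W k) (seq Z k))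
    (≤ℝ-trans {Z *ℝ W} {B *ℝ W} {W *ℝ (1ℝ +ℝ ε) *ℝ f *ℝ c}
      (*ℝ-monoʳ {Z} {B} {W} W≥0 hZ)
      (≤ℝ-pointwise {B *ℝ W} {W *ℝ (1ℝ +ℝ ε) *ℝ f *ℝ c} λ k →
        solve 4 (λ F E c W → F :* E :* c :* W := W :* E :* F :* c) refl
          (ι (suc m)) (1ℚ + seq ε k) (seq c k) (seq W k)))))

-- A greatest lower bound need not be approximated by elements of `S`. Dividing by `y` turns the
-- hypothesis into x/y being a lower bound, which is the form that `IsInfimum` can use.
≤-infimum : ∀ {S t x y} → 0ℝ <ℝ y → IsInfimum S t → (∀ s → S s → x ≤ℝ s *ℝ y) → x ≤ℝ t *ℝ y
≤-infimum {S} {t} {x} {y} y>0 (_ , greatest) h =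
  /ℝ-≤⇒≤ℝ-* {x} {y} {t} y>0 (greatest (x /ℝ y ⟨ y>0 ⟩) λ s s∈ → ≤ℝ-*⇒/ℝ-≤ {x} {y} {s} y>0 (h s s∈))

-- Truncation at f is subadditive, since the right side already reaches f once one summand does.
-- Hence truncating the multiplicities keeps an f-fold cover.
⊓-sum : {A : Set} (g : A → ℕ) (f : ℕ) (xs : List A) →
  f ℕ.≤ sum (map g xs) → f ℕ.≤ sum (map (λ a → g a ℕ.⊓ f) xs)
⊓-sum g f xs f≤ = ℕP.≤-trans (ℕP.≤-reflexive (sym (ℕP.m≥n⇒m⊓n≡n f≤))) (truncated xs)
  where
  subadditive : ∀ a S → (a ℕ.+ S) ℕ.⊓ f ℕ.≤ a ℕ.⊓ f ℕ.+ S ℕ.⊓ f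
  subadditive a S with ℕP.≤-total a f | ℕP.≤-total S f
  ... | inj₂ f≤a | _ rewrite ℕP.m≥n⇒m⊓n≡n f≤a =
    ℕP.≤-trans (ℕP.m⊓n≤n (a ℕ.+ S) f) (ℕP.m≤m+n f _)
  ... | inj₁ a≤f | inj₁ S≤f rewrite ℕP.m≤n⇒m⊓n≡m a≤f | ℕP.m≤n⇒m⊓n≡m S≤f = ℕP.m⊓n≤m (a ℕ.+ S) f
  ... | inj₁ a≤f | inj₂ f≤S rewrite ℕP.m≥n⇒m⊓n≡n f≤S =
    ℕP.≤-trans (ℕP.m⊓n≤n (a ℕ.+ S) f) (ℕP.m≤n+m f _)
  truncated : ∀ xs → sum (map g xs) ℕ.⊓ f ℕ.≤ sum (map (λ a → g a ℕ.⊓ f) xs)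
  truncated []       = ℕ.z≤n
  truncated (x ∷ xs) = ℕP.≤-trans (subadditive (g x) _) (ℕP.+-monoʳ-≤ (g x ℕ.⊓ f) (truncated xs))

-- Fractional transversals from multisets, and greedy runs for rational λ

module _ (H : Hypergraph) where
  open Hypergraph H

  seq-∑-÷ℕ : ∀ m (A : Multiset) (xs : List Vertex) k →
    seq (∑ xs λ x → fromℕ (A x) ÷ℕ suc m) k ≡ ι (sum (map A xs)) * (+ 1 / suc m)
  seq-∑-÷ℕ m A xs k = trans (seq-∑ xs _ k) (trans (Σ-cong xs λ x → *-comm (ι (A x)) (+ 1 / suc m))
    (trans (Σ-*ˡ xs (+ 1 / suc m) _) (trans (cong ((+ 1 / suc m) *_) (Σ-ι xs A)) (*-comm (+ 1 / suc m) _))))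

  transversal⇒fractional : ∀ m A → (∀ x → A x ℕ.≤ suc m) → IsTransversal (suc m) A →
    IsFractionalTransversal λ x → fromℕ (A x) ÷ℕ suc m
  transversal⇒fractional m A A≤f t =
    (λ x → ≤ℝ-eventually {0ℝ} {fromℕ (A x) ÷ℕ suc m} (ev-pure λ _ → 0≤* (0≤ι (A x)) (<⇒≤ (0<1/ m)))
         , ≤ℝ-trans {fromℕ (A x) ÷ℕ suc m} {fromℕ (suc m) ÷ℕ suc m} {1ℝ} (÷ℕ-mono m (A≤f x))
             (≤ℝ-pointwise {fromℕ (suc m) ÷ℕ suc m} {1ℝ} λ _ → ι*1/ m))
    , λ F F∈ → ≤ℝ-eventually {1ℝ} {∑ (members F) λ x → fromℕ (A x) ÷ℕ suc m} (ev-pure λ k →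
        ≤-trans (≤-reflexive (sym (ι*1/ m)))
          (≤-trans (*-monoʳ (<⇒≤ (0<1/ m)) (ι-mono (t F F∈)))
            (≤-reflexive (sym (seq-∑-÷ℕ m A (members F) k)))))

  infimum≤weight : ∀ {τ* w} → IsFractionalTransversalNumber τ* → IsFractionalTransversal w →
    τ* ≤ℝ totalWeight w
  infimum≤weight {τ*} {w} (lower , _) ft = lower (totalWeight w)
    (w , ft , ≤ℝ-pointwise {totalWeight w} {totalWeight w} (λ _ → refl)
            , ≤ℝ-pointwise {totalWeight w} {totalWeight w} (λ _ → refl))

  infimum≤τ/f : ∀ {τ* t} m → IsFractionalTransversalNumber τ* → IsTransversalNumber (suc m) t →
    τ* ≤ℝ fromℕ t ÷ℕ suc m
  infimum≤τ/f {τ*} m inf ((A , A-t , refl) , _) =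
    ≤ℝ-trans {τ*} {totalWeight w} {fromℕ (size A) ÷ℕ suc m}
      (infimum≤weight {τ*} {w} inf (transversal⇒fractional m A⊓f (λ x → ℕP.m⊓n≤n (A x) (suc m))
        λ F F∈ → ⊓-sum A (suc m) (members F) (A-t F F∈)))
      (≤ℝ-trans {totalWeight w} {fromℕ (size A⊓f) ÷ℕ suc m} {fromℕ (size A) ÷ℕ suc m}
        (≤ℝ-pointwise {totalWeight w} {fromℕ (size A⊓f) ÷ℕ suc m} (seq-∑-÷ℕ m A⊓f vertices))
        (÷ℕ-mono m (sum-map-mono vertices λ x → ℕP.m⊓n≤m (A x) (suc m))))
    where
    A⊓f : Multiset
    A⊓f x = A x ℕ.⊓ suc m
    w : Vertex → ℝ
    w x = fromℕ (A⊓f x) ÷ℕ suc m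

  module _ (f : ℕ) (lam : ℝ) (q : ℚ) (lam≃q : lam ≃ fromℚ q) (lam>0 : 0ℝ <ℝ lam)
           (q>0 : 0ℚ < q) (q<1 : q < 1ℚ) where
    open Core H f q q>0 q<1
    open Greedy lam f

    seq-valueℚ : ∀ A x k → seq (∑ (filter (λ F → hits A F ℕP.<? f) (filter (x ∈?_) edges))
                     λ F → fromℚ q ^ℝ hits A F) k ≡ valueℚ A x
    seq-valueℚ A x k = trans (seq-∑ Fs _ k) (Σ-cong Fs λ F → seq-^ (fromℚ q) (hits A F) k)
      where Fs = filter (λ F → hits A F ℕP.<? f) (filter (x ∈?_) edges)

    value≃valueℚ : ∀ A x → value A x ≃ fromℚ (valueℚ A x)
    value≃valueℚ A x =
      ≤ℝ-trans {value A x} {v} {fromℚ (valueℚ A x)}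
        (∑-mono Fs λ F → ^ℝ-mono {lam} {fromℚ q} (hits A F) (<⇒≤ℝ {0ℝ} {lam} lam>0) (proj₁ lam≃q))
        (≤ℝ-pointwise {v} {fromℚ (valueℚ A x)} (seq-valueℚ A x)) ,
      ≤ℝ-trans {fromℚ (valueℚ A x)} {v} {value A x}
        (≤ℝ-pointwise {fromℚ (valueℚ A x)} {v} λ k → sym (seq-valueℚ A x k))
        (∑-mono Fs λ F → ^ℝ-mono {fromℚ q} {lam} (hits A F)
          (≤ℝ-trans {0ℝ} {lam} {fromℚ q} (<⇒≤ℝ {0ℝ} {lam} lam>0) (proj₁ lam≃q)) (proj₂ lam≃q))
      where
      Fs = filter (λ F → hits A F ℕP.<? f) (filter (x ∈?_) edges)
      v = ∑ Fs λ F → fromℚ q ^ℝ hits A F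

    -- This is where rationality of λ enters: all values are then rational up to `_≃_`, and their
    -- comparisons transfer exactly. At a merely nearby rational, a vertex tied for the largest
    -- value may lose the tie.
    run⇒runℚ : ∀ {ps} → Run ps → Runℚ ps
    run⇒runℚ start = start
    run⇒runℚ (pick {ps} x run ¬t max) = pick x (run⇒runℚ run) ¬t λ y → let A = multiplicity ps in
      fromℚ-cancel-≤ (≤ℝ-trans {fromℚ (valueℚ A y)} {value A y} {fromℚ (valueℚ A x)}
        (proj₂ (value≃valueℚ A y))
        (≤ℝ-trans {value A y} {value A x} {fromℚ (valueℚ A x)} (max y) (proj₁ (value≃valueℚ A x))))

  -- Excludes f = 0, where division by f takes its default value. The inequality would force ln Δ ≤
  -- -1 although Δ ≥ 1; with exponent 0 for λ, `exp-ln-lower` bounds the approximants of exp at ln Δ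
  -- alone.
  ceiling≢0 : ∀ {M L lam ε c} → IsExp M (fromℕ maxDegree) → IsExp L lam → 0ℝ <ℝ lam →
    ¬ fromℕ 2 *ℝ (1ℝ +ℝ M) ≤ℝ fromℕ 0 *ℝ (ε *ℝ c)
  ceiling≢0 {M} {L} {lam} {ε} {c} expM expL lam>0 h =
    let ¼>0 = positive⁻¹ (½ * ½)
        n , ev = exp-ln-lower M L lam maxDegree 0 (½ * ½) expM expL (1≤maxDegree H) lam>0 ¼>0 (<⇒≤ (<-by {d = ½ + ½ * ½} (positive⁻¹ (½ + ½ * ½)) refl))
        k , p = ev & h ½ 0<½
        (t≥0 , Δ<) , h′ = p k ℕP.≤-refl
    in absurd n (seq M k) (seq L k) (seq ε k * seq c k) t≥0 Δ< h′
    where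
    absurd : ∀ n μ l z → let t = 1ℚ + (μ - 0ℚ * l + (½ * ½ + ½ * ½)) * (+ 1 / suc n) in
      0ℚ ≤ t → ι maxDegree < t ^ suc n * 1ℚ →
      (1ℚ + 1ℚ) * (1ℚ + μ) ≤ 0ℚ * z + ½ → ⊥
    absurd n μ l z t≥0 Δ< h = <⇒≱ Δ<
      (≤-trans (≤-reflexive (*-identityʳ _)) (≤-trans (^≤1 (suc n) t≥0 t≤1) (ι-mono {1} {maxDegree} (1≤maxDegree H))))
      where
      -- The hypothesis, read with error 1/2, gives μ ≤ -3/4, and the overshoot 2η is only 1/2.
      s≤0 : μ - 0ℚ * l + (½ * ½ + ½ * ½) ≤ 0ℚ
      s≤0 = ≤-by {d = ½ * (0ℚ * z + ½ - (1ℚ + 1ℚ) * (1ℚ + μ)) + ½ * ½}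
        (0≤+ (0≤* (<⇒≤ 0<½) (gap h)) (<⇒≤ (positive⁻¹ (½ * ½))))
        (solve 3 (λ μ l z → μ :- con 0ℚ :* l :+ con (½ * ½ + ½ * ½)
           :+ (con ½ :* (con 0ℚ :* z :+ con ½ :- (con 1ℚ :+ con 1ℚ) :* (con 1ℚ :+ μ)) :+ con (½ * ½)) := con 0ℚ) refl μ l z)
      t≤1 : 1ℚ + (μ - 0ℚ * l + (½ * ½ + ½ * ½)) * (+ 1 / suc n) ≤ 1ℚ
      t≤1 = ≤-trans (+-monoʳ-≤ 1ℚ (*-monoʳ (<⇒≤ (0<1/ n)) s≤0))
        (≤-reflexive (trans (cong (λ t → 1ℚ + t) (*-zeroˡ (+ 1 / suc n))) (+-identityʳ 1ℚ)))

IsExp-resp-≃ : ∀ {y x x′} → x ≃ x′ → IsExp y x → IsExp y x′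
IsExp-resp-≃ {y} {x} {x′} (x≤ , x≥) exp e e>0 = let N , h = exp e e>0 in N , λ n N≤n →
  let a = (1ℝ +ℝ y ÷ℕ suc n) ^ℝ suc n ; lower , upper = h n N≤n in
  ≤ℝ-trans {a} {x +ℝ fromℚ e} {x′ +ℝ fromℚ e} lower
    (+ℝ-mono {x} {x′} {fromℚ e} {fromℚ e} x≤ (≤ℝ-pointwise {fromℚ e} {fromℚ e} λ _ → refl)) ,
  ≤ℝ-trans {x′} {x} {a +ℝ fromℚ e} x≥ upper

-- Combination of the bounds

module _ (H : Hypergraph) where
  open Hypergraph H

  infimum-bound : ∀ {ε lam M L τ*} m n → 0ℝ <ℝ ε → 0ℝ <ℝ 1ℝ -ℝ lam →
    -ℝ L ≤ℝ (1ℝ +ℝ ε ÷ℕ 2) *ℝ (1ℝ -ℝ lam) →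
    fromℕ 2 *ℝ (1ℝ +ℝ M) ≤ℝ fromℕ (suc m) *ℝ (ε *ℝ (1ℝ -ℝ lam)) →
    IsFractionalTransversalNumber τ* →
    (∀ w → IsFractionalTransversal w →
      (1ℝ -ℝ lam) *ℝ fromℕ n ≤ℝ totalWeight w *ℝ (1ℝ +ℝ (M -ℝ fromℕ (suc m) *ℝ L))) →
    fromℕ n ÷ℕ suc m ≤ℝ τ* *ℝ (1ℝ +ℝ ε)
  infimum-bound {ε} {lam} {M} {L} {τ*} m n ε>0@(d , d>0 , ev) c>0 hL hM inf bound =
    ≤-infimum {_} {τ*} {fromℕ n ÷ℕ suc m} {1ℝ +ℝ ε} 1+ε>0 inf λ s (w , ft , _ , w≤s) →
      ≤ℝ-trans {fromℕ n ÷ℕ suc m} {totalWeight w *ℝ (1ℝ +ℝ ε)} {s *ℝ (1ℝ +ℝ ε)}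
        (scale-bound {totalWeight w} {1ℝ +ℝ (M -ℝ fromℕ (suc m) *ℝ L)} {ε} {1ℝ -ℝ lam} m n c>0
          (0≤∑ vertices {w} λ x → proj₁ (proj₁ ft x)) (bound w ft)
          (exponent-bound {M} {L} {ε} {1ℝ -ℝ lam} (suc m) hL hM))
        (*ℝ-monoʳ {totalWeight w} {s} {1ℝ +ℝ ε} (<⇒≤ℝ {0ℝ} {1ℝ +ℝ ε} 1+ε>0) w≤s)
    where
    1+ε>0 : 0ℝ <ℝ 1ℝ +ℝ ε
    1+ε>0 = d , d>0 , ev-map (λ {k} h → ≤-trans h (≤-by 0≤1 (+-comm (seq ε k) 1ℚ))) ev

corollary1p3 : (H : Hypergraph) → let open Hypergraph H in
    (ε : ℝ) (0<ε : 0ℝ <ℝ ε) → ε ≤ℝ 1ℝ →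
    (lam : ℝ) → 0ℝ <ℝ lam → (lam<1 : lam <ℝ 1ℝ) →
    (ln-lam : ℝ) → IsLn lam ln-lam →
    (-ℝ ln-lam) /ℝ (1ℝ -ℝ lam) ⟨ x<1⇒0<1-x {lam} lam<1 ⟩ ≤ℝ 1ℝ +ℝ ε ÷ℕ 2 →
    (ln-Δ : ℝ) → IsLn (fromℕ maxDegree) ln-Δ →
    (f : ℕ) →
    IsCeiling
    ((fromℕ 2 *ℝ (1ℝ +ℝ ln-Δ))
    /ℝ (ε *ℝ (1ℝ -ℝ lam))
    ⟨ *-positive {ε} {1ℝ -ℝ lam} 0<ε (x<1⇒0<1-x {lam} lam<1) ⟩)
    (+ f) →
    (τ-f : ℕ) → IsTransversalNumber f τ-f →
    (τ* : ℝ) → IsFractionalTransversalNumber τ* →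
    (τ* ≤ℝ fromℕ τ-f ÷ℕ f × fromℕ τ-f ÷ℕ f ≤ℝ τ* *ℝ (1ℝ +ℝ ε)) ×
    (IsRational lam →
    (A : Multiset) → Greedy.IsOutput lam f A →
    let w = λ (x : Vertex) → fromℕ (A x) ÷ℕ f in
    IsFractionalTransversal w ×
    τ* ≤ℝ totalWeight w ×
    totalWeight w ≤ℝ τ* *ℝ (1ℝ +ℝ ε))
corollary1p3 H ε 0<ε _ lam 0<lam lam<1 L isL hL M isM zero (hM , _) _ _ _ _ =
  ⊥-elim (ceiling≢0 H {M} {L} {lam} {ε} {1ℝ -ℝ lam} isM isL 0<lam
    (/ℝ-≤⇒≤ℝ-* {fromℕ 2 *ℝ (1ℝ +ℝ M)} {ε *ℝ (1ℝ -ℝ lam)} {fromℕ 0}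
      (*-positive {ε} {1ℝ -ℝ lam} 0<ε (x<1⇒0<1-x {lam} lam<1)) hM))
corollary1p3 H ε 0<ε _ lam 0<lam lam<1 L isL hL M isM f@(suc m) (hM , _) τ-f isτ-f@(_ , τ-f-least) τ* isτ* =
  (infimum≤τ/f H {τ*} m isτ* isτ-f , bound τ-f λ w ft →
    -- Every term of λ in (0,1) has its own greedy run; its output is an f-fold transversal, so its
    -- length is at least `τ-f` whatever the term.
    weight-bound H lam M L f τ-f w 0<lam lam<1 isM isL ft (ev-pure λ k q>0 q<1 →
      let ps , run , t = Core.greedyRun H f (seq lam k) q>0 q<1 in
      ps , run , ℕP.≤-trans (τ-f-least (multiplicity ps) t) (ℕP.≤-reflexive (size-multiplicity H ps)))) ,
  greedy-output
  where
  open Hypergraph H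
  1-lam>0 : 0ℝ <ℝ 1ℝ -ℝ lam
  1-lam>0 = x<1⇒0<1-x {lam} lam<1
  bound : ∀ n → (∀ w → IsFractionalTransversal w →
      (1ℝ -ℝ lam) *ℝ fromℕ n ≤ℝ totalWeight w *ℝ (1ℝ +ℝ (M -ℝ fromℕ f *ℝ L))) →
    fromℕ n ÷ℕ f ≤ℝ τ* *ℝ (1ℝ +ℝ ε)
  bound n = infimum-bound H {ε} {lam} {M} {L} {τ*} m n 0<ε 1-lam>0
    (/ℝ-≤⇒≤ℝ-* { -ℝ L} {1ℝ -ℝ lam} {1ℝ +ℝ ε ÷ℕ 2} 1-lam>0 hL)
    (/ℝ-≤⇒≤ℝ-* {fromℕ 2 *ℝ (1ℝ +ℝ M)} {ε *ℝ (1ℝ -ℝ lam)} {fromℕ f}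
      (*-positive {ε} {1ℝ -ℝ lam} 0<ε 1-lam>0) hM)
    isτ*
  greedy-output : IsRational lam → (A : Multiset) → Greedy.IsOutput lam f A →
    let w = λ (x : Vertex) → fromℕ (A x) ÷ℕ f in
    IsFractionalTransversal w × τ* ≤ℝ totalWeight w × totalWeight w ≤ℝ τ* *ℝ (1ℝ +ℝ ε)
  greedy-output (q , lam≃q) A (ps , run , t , A≡) =
    fractional , infimum≤weight H {τ*} {w} isτ* fractional ,
    ≤ℝ-trans {totalWeight w} {fromℕ (length ps) ÷ℕ f} {τ* *ℝ (1ℝ +ℝ ε)}
      (≤ℝ-pointwise {totalWeight w} {fromℕ (length ps) ÷ℕ f} λ k →
        trans (seq-∑-÷ℕ H m A vertices k) (cong (λ n → ι n * (+ 1 / f)) size≡length))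
      (bound (length ps) λ v ft →
        ≤ℝ-trans {(1ℝ -ℝ lam) *ℝ fromℕ (length ps)} {(1ℝ -ℝ fromℚ q) *ℝ fromℕ (length ps)}
            {totalWeight v *ℝ (1ℝ +ℝ (M -ℝ fromℕ f *ℝ L))}
          (*ℝ-monoʳ {1ℝ -ℝ lam} {1ℝ -ℝ fromℚ q} {fromℕ (length ps)}
            (≤ℝ-eventually {0ℝ} {fromℕ (length ps)} (ev-pure λ _ → 0≤ι (length ps)))
            (+ℝ-mono {1ℝ} {1ℝ} { -ℝ lam} { -ℝ fromℚ q} (≤ℝ-pointwise {1ℝ} {1ℝ} λ _ → refl)
              (-ℝ-antitone {fromℚ q} {lam} (proj₂ lam≃q))))
          -- With the constant sequence `q` in place of the terms of λ, the one given run serves at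
          -- every index.
          (weight-bound H (fromℚ q) M L f (length ps) v 0<q q<1ℝ isM
            (IsExp-resp-≃ {L} {lam} {fromℚ q} lam≃q isL) ft
            (ev-pure λ _ q>0 q<1 → ps , run⇒runℚ H f lam q lam≃q 0<lam q>0 q<1 run , ℕP.≤-refl)))
    where
    w : Vertex → ℝ
    w x = fromℕ (A x) ÷ℕ f
    0<q : 0ℝ <ℝ fromℚ q
    0<q = <-≤ℝ-trans {0ℝ} {lam} {fromℚ q} 0<lam (proj₁ lam≃q)
    q<1ℝ : fromℚ q <ℝ 1ℝ
    q<1ℝ = ≤-<ℝ-trans {fromℚ q} {lam} {1ℝ} (proj₂ lam≃q) lam<1
    fractional : IsFractionalTransversal w
    fractional = transversal⇒fractional H m A
      (λ x → subst (ℕ._≤ f) (sym (A≡ x)) (Core.multiplicity≤f H f q (fromℚ-cancel-< 0<q) (fromℚ-cancel-< q<1ℝ)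
        (run⇒runℚ H f lam q lam≃q 0<lam (fromℚ-cancel-< 0<q) (fromℚ-cancel-< q<1ℝ) run) x))
      (λ F F∈ → subst (f ℕ.≤_) (sym (hits-cong H A≡ F)) (t F F∈))
    size≡length : size A ≡ length ps
    size≡length = trans (cong sum (map-cong A≡ vertices)) (size-multiplicity H ps)
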